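{- Let $x_1,x_2,y_1,y_2,u_1,u_2,v_1,v_2,w_{\rm e},w_{\rm o},z_{\rm e},z_{\rm o},\lambda$ be commuting indeterminates and for $n\ge0$ let \[ \widehat{P}_n=\sum_{\sigma\in\mathfrak{D}_{2n}}x_1^{\mathrm{eareccpeak}}x_2^{\mathrm{eareccdfall}}y_1^{\mathrm{ereccval}}y_2^{\mathrm{ereccdrise}}u_1^{\mathrm{nrcpeak}}u_2^{\mathrm{nrcdfall}}v_1^{\mathrm{nrcval}}v_2^{\mathrm{nrcdrise}}w_{\rm e}^{\mathrm{evennrfix}}w_{\rm o}^{\mathrm{oddnrfix}}z_{\rm e}^{\mathrm{evenrar}}z_{\rm o}^{\mathrm{oddrar}}\lambda^{\mathrm{cyc}}, \] all statistics evaluated at $\sigma$. Then, with $v_1$ specialised to $y_1$, \[ \sum_{n\ge0}\widehat{P}_n\,t^n=\cfrac{1}{1-\delta_1t-\cfrac{\alpha_1t}{1-\delta_2t-\cfrac{\alpha_2t}{1-\delta_3 t-\cdots}}} \] as formal power series in $t$, where for $k\ge1$: $\alpha_{2k-1}=(\lambda+k-1)[x_1+(k-1)u_1]\,y_1$, $\alpha_{2k}=[x_2+(k-1)u_2+\lambda w_{\rm e}][y_2+(k-1)v_2+\lambda w_{\rm o}]$, and $\delta_1=\lambda^2z_{\rm e}z_{\rm o}$, $\delta_n=0$ for $n\ge2$.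
   Context: A D-permutation of $[2n]$ is a permutation $\sigma$ with $\sigma(2k-1)\ge 2k-1$ and $\sigma(2k)\le 2k$ for all $k$; $\mathfrak{D}_{2n}$ is the set of them ($\mathfrak{D}_0$ contains the empty permutation). For a permutation $\sigma$, an index $i$ is a cycle peak if $\sigma^{ -1}(i)<i>\sigma(i)$, cycle valley if $\sigma^{ -1}(i)>i<\sigma(i)$, cycle double rise if $\sigma^{ -1}(i)<i<\sigma(i)$, cycle double fall if $\sigma^{ -1}(i)>i>\sigma(i)$, fixed point if $\sigma(i)=i$. Index $i$ is a record if $\sigma(j)<\sigma(i)$ for all $j<i$, an antirecord if $\sigma(j)>\sigma(i)$ for all $j>i$; exclusive record = record not antirecord; exclusive antirecord = antirecord not record; record-antirecord = both; nr = neither. $\mathrm{eareccpeak},\mathrm{eareccdfall}$ count cycle peaks, cycle double falls that are exclusive antirecords; $\mathrm{ereccval},\mathrm{ereccdrise}$ count cycle valleys, cycle double rises that are exclusive records; $\mathrm{nrcpeak},\mathrm{nrcdfall},\mathrm{nrcval},\mathrm{nrcdrise}$ count cycle peaks, double falls, valleys, double rises that are neither records nor antirecords; $\mathrm{evennrfix}$ ($\mathrm{oddnrfix}$) counts even (odd) fixed points that are neither records nor antirecords; $\mathrm{evenrar}$ ($\mathrm{oddrar}$) counts even (odd) indices that are record-antirecords. $\mathrm{cyc}(\sigma)$ is the number of cycles (fixed points included). -}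

module Defs where

open import Level using (Level)
open import Data.Bool.Base using (Bool; true; false; _∧_; _∨_; not; if_then_else_)
open import Data.Nat.Base as ℕ using (ℕ; zero; suc; _∸_; _<ᵇ_; _≤ᵇ_; _≡ᵇ_)
open import Data.Fin.Base using (Fin; toℕ)
open import Data.Vec.Base using (Vec; []; _∷_; lookup)
open import Data.List.Base using (List; []; _∷_; [_]; map; concatMap; allFin; filterᵇ; upTo; foldr; length)
open import Data.Bool.ListAction using (all; any)
open import Algebra.Bundles using (CommutativeRing)

-- Combinatorics of D-permutations.
-- A permutation of [m] is represented by a vector σ : Vec (Fin m) m;
-- position i : Fin m stands for the integer toℕ i + 1 ∈ [m], and the
-- value lookup σ i stands for the integer toℕ (lookup σ i) + 1.
-- (Comparisons are invariant under this shift of both sides by 1;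
--  parity is flipped, which is accounted for below.)

evenᵇ : ℕ → Bool
evenᵇ zero = true
evenᵇ (suc n) = not (evenᵇ n)

vecs : (m k : ℕ) → List (Vec (Fin m) k)
vecs m zero = [ [] ]
vecs m (suc k) = concatMap (λ f → map (f ∷_) (vecs m k)) (allFin m)

countᵇ : {A : Set} → (A → Bool) → List A → ℕ
countᵇ p xs = length (filterᵇ p xs)

module Perm {m : ℕ} (σ : Vec (Fin m) m) where

  fins : List (Fin m)
  fins = allFin m

  pos : Fin m → ℕ
  pos i = toℕ i

  ap : Fin m → ℕ
  ap i = toℕ (lookup σ i)

  isPerm : Bool
  isPerm = all (λ i → all (λ j → not (ap i ≡ᵇ ap j) ∨ (pos i ≡ᵇ pos j)) fins) fins

  -- D-condition: σ(2k-1) ≥ 2k-1 and σ(2k) ≤ 2k  (1-based);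
  -- 1-based odd  ⇔ 0-based even.
  isD : Bool
  isD = all (λ i → if evenᵇ (pos i) then pos i ≤ᵇ ap i else ap i ≤ᵇ pos i) fins

  -- the (unique, for a permutation) preimage σ⁻¹(i) satisfies rel
  pre : Fin m → (ℕ → Bool) → Bool
  pre i rel = any (λ j → (ap j ≡ᵇ pos i) ∧ rel (pos j)) fins

  cpeak cval cdrise cdfall fix : Fin m → Bool
  cpeak  i = pre i (λ p → p <ᵇ pos i) ∧ (ap i <ᵇ pos i)
  cval   i = pre i (λ p → pos i <ᵇ p) ∧ (pos i <ᵇ ap i)
  cdrise i = pre i (λ p → p <ᵇ pos i) ∧ (pos i <ᵇ ap i)
  cdfall i = pre i (λ p → pos i <ᵇ p) ∧ (ap i <ᵇ pos i)
  fix    i = ap i ≡ᵇ pos i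

  rec arec : Fin m → Bool
  rec  i = all (λ j → not (pos j <ᵇ pos i) ∨ (ap j <ᵇ ap i)) fins
  arec i = all (λ j → not (pos i <ᵇ pos j) ∨ (ap i <ᵇ ap j)) fins

  erec earec rar nr : Fin m → Bool
  erec  i = rec i ∧ not (arec i)
  earec i = arec i ∧ not (rec i)
  rar   i = rec i ∧ arec i
  nr    i = not (rec i) ∧ not (arec i)

  -- parity of the 1-based index toℕ i + 1
  evenIdx oddIdx : Fin m → Bool
  evenIdx i = not (evenᵇ (pos i))
  oddIdx  i = evenᵇ (pos i)

  eareccpeak eareccdfall ereccval ereccdrise : ℕ
  eareccpeak  = countᵇ (λ i → earec i ∧ cpeak i) fins
  eareccdfall = countᵇ (λ i → earec i ∧ cdfall i) fins
  ereccval    = countᵇ (λ i → erec i ∧ cval i) fins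
  ereccdrise  = countᵇ (λ i → erec i ∧ cdrise i) fins

  nrcpeak nrcdfall nrcval nrcdrise : ℕ
  nrcpeak  = countᵇ (λ i → nr i ∧ cpeak i) fins
  nrcdfall = countᵇ (λ i → nr i ∧ cdfall i) fins
  nrcval   = countᵇ (λ i → nr i ∧ cval i) fins
  nrcdrise = countᵇ (λ i → nr i ∧ cdrise i) fins

  evennrfix oddnrfix evenrar oddrar : ℕ
  evennrfix = countᵇ (λ i → evenIdx i ∧ nr i ∧ fix i) fins
  oddnrfix  = countᵇ (λ i → oddIdx i ∧ nr i ∧ fix i) fins
  evenrar   = countᵇ (λ i → evenIdx i ∧ rar i) fins
  oddrar    = countᵇ (λ i → oddIdx i ∧ rar i) fins

  iter : ℕ → Fin m → Fin m
  iter zero i = i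
  iter (suc k) i = lookup σ (iter k i)

  cycMin : Fin m → Bool
  cycMin i = all (λ k → pos i ≤ᵇ toℕ (iter k i)) (upTo m)

  cyc : ℕ
  cyc = countᵇ cycMin fins

Dperms : (n : ℕ) → List (Vec (Fin (n ℕ.+ n)) (n ℕ.+ n))
Dperms n = filterᵇ (λ σ → Perm.isPerm σ ∧ Perm.isD σ) (vecs (n ℕ.+ n) (n ℕ.+ n))

-- Algebra over an arbitrary commutative ring R (values of the indeterminates)

module Series {c ℓ : Level} (R : CommutativeRing c ℓ) where
  open CommutativeRing R

  pow : Carrier → ℕ → Carrier
  pow a zero = 1#
  pow a (suc k) = a * pow a k

  nat : ℕ → Carrier
  nat zero = 0#
  nat (suc k) = 1# + nat k

  sumL : List Carrier → Carrier
  sumL = foldr _+_ 0#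

  weight : (x₁ x₂ y₁ y₂ u₁ u₂ v₁ v₂ wₑ wₒ zₑ zₒ λ' : Carrier)
           → {m : ℕ} → Vec (Fin m) m → Carrier
  weight x₁ x₂ y₁ y₂ u₁ u₂ v₁ v₂ wₑ wₒ zₑ zₒ λ' σ =
      pow x₁ eareccpeak * pow x₂ eareccdfall * pow y₁ ereccval * pow y₂ ereccdrise
    * pow u₁ nrcpeak * pow u₂ nrcdfall * pow v₁ nrcval * pow v₂ nrcdrise
    * pow wₑ evennrfix * pow wₒ oddnrfix * pow zₑ evenrar * pow zₒ oddrar
    * pow λ' cyc
    where open Perm σ

  Phat : (x₁ x₂ y₁ y₂ u₁ u₂ v₁ v₂ wₑ wₒ zₑ zₒ λ' : Carrier) → ℕ → Carrier
  Phat x₁ x₂ y₁ y₂ u₁ u₂ v₁ v₂ wₑ wₒ zₑ zₒ λ' n =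
    sumL (map (weight x₁ x₂ y₁ y₂ u₁ u₂ v₁ v₂ wₑ wₒ zₑ zₒ λ') (Dperms n))

  PS : Set c
  PS = ℕ → Carrier

  oneS : PS
  oneS zero = 1#
  oneS (suc n) = 0#

  constS : Carrier → PS
  constS a zero = a
  constS a (suc n) = 0#

  _⊛_ : PS → PS → PS
  (f ⊛ g) n = sumL (map (λ k → f k * g (n ∸ k)) (upTo (suc n)))

  tS : PS → PS
  tS f zero = 0#
  tS f (suc n) = f n

  powS : PS → ℕ → PS
  powS f zero = oneS
  powS f (suc j) = f ⊛ powS f j

  -- 1/(1 - t g) = Σ_j (t g)^j ; the t^n coefficient only involves j ≤ n
  geomT : PS → PS
  geomT g n = sumL (map (λ j → powS (tS g) j n) (upTo (suc n)))

  half : ℕ → ℕ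
  half zero = 0
  half (suc zero) = 0
  half (suc (suc n)) = suc (half n)

  module CF (x₁ x₂ y₁ y₂ u₁ u₂ v₂ wₑ wₒ zₑ zₒ λ' : Carrier) where
    -- αI i = α_{i+1},  δI i = δ_{i+1}
    -- α_{2k-1} = (λ+k-1)[x₁+(k-1)u₁] y₁ ,  α_{2k} = [x₂+(k-1)u₂+λwₑ][y₂+(k-1)v₂+λwₒ]
    αI : ℕ → Carrier
    αI i = if evenᵇ i
           then (λ' + nat (half i)) * (x₁ + nat (half i) * u₁) * y₁
           else (x₂ + nat (half i) * u₂ + λ' * wₑ) * (y₂ + nat (half i) * v₂ + λ' * wₒ)

    δI : ℕ → Carrier
    δI zero = λ' * λ' * zₑ * zₒ
    δI (suc i) = 0#

    -- J i d : the continued fraction starting at level i+1, truncated after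
    -- d levels (tail replaced by 1):
    -- J i (suc d) = 1 / (1 - δ_{i+1} t - α_{i+1} t · J (i+1) d)
    J : ℕ → ℕ → PS
    J i zero = oneS
    J i (suc d) = geomT (λ n → δI i * oneS n + αI i * J (suc i) d n)

    cfCoeff : ℕ → ℕ → Carrier
    cfCoeff N n = J 0 N n

{-# OPTIONS --safe #-}
module Submission where

-- Read a D-permutation σ of [2n] from the last position down. Once the positions ≥ i are
-- assigned, the edges j → σ(j) with j ≥ i form cycles and paths; the paths match the
-- values still missing with the positions < i. Each factor of the weight of σ is then
-- decided locally at i: position i is the least element of its cycle exactly when σ(i) is
-- the start of the path ending at i; an excedance is a record exactly when σ(i) is the
-- largest missing value; a deficiency is an antirecord exactly when no later value is
-- smaller. If h later positions take values below i, then h values above i are missing, so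
-- a valley contributes (λ+h-1)y₁, a double rise y₂+(h-1)v₂ and so on, and the positions
-- below i see the later ones only through the set S of values below i already taken. The
-- choices of the deficiencies change S, but the sum over all S of given cardinality h
-- again has a product form. What remains is a sum over lattice paths, whose generating
-- functions are products of consecutive tails of the continued fraction.

open import Defs
open import Level using (Level)
open import Algebra.Bundles using (CommutativeRing)
import Algebra.Properties.CommutativeSemigroup as CSG
import Algebra.Properties.Group as GroupProperties
import Algebra.Solver.Ring.NaturalCoefficients.Default as Solver
open import Data.Bool.Base using (Bool; true; false; not; _∧_; _∨_; if_then_else_)
open import Data.Bool.ListAction using (all; any)
open import Data.Bool.Properties using (∧-zeroʳ)
open import Data.Fin.Base using (Fin; zero; suc; toℕ)
open import Data.Fin.Properties using (toℕ<n; toℕ-injective; pigeonhole)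
open import Data.List.Base using (List; []; _∷_; _++_; map; concatMap; foldr; filterᵇ; tabulate; allFin; upTo; applyUpTo)
open import Data.List.Membership.Propositional using (_∈_; _∉_)
open import Data.List.Membership.Propositional.Properties using (∈-allFin; ∈-upTo⁺)
open import Data.List.Properties using (map-upTo; map-tabulate)
open import Data.List.Relation.Unary.Any using (here; there)
open import Data.Nat.Base as ℕ using (ℕ; zero; suc; _∸_; _<_; _≤_; _<ᵇ_; _≤ᵇ_; _≡ᵇ_; z≤n; s≤s)
import Data.Nat.Properties as ℕₚ
open ℕₚ using (_≟_; _<?_; _≤?_)
open import Data.List.Membership.DecPropositional _≟_ using (_∈?_)
open import Data.Product.Base using (∃; _×_; _,_; proj₁; proj₂)
open import Data.Sum.Base using (_⊎_; inj₁; inj₂)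
open import Data.Vec.Base using (Vec; []; _∷_; lookup)
open import Function.Base using (_∘_; id)
open import Relation.Binary.Definitions using (tri<; tri≈; tri>)
import Relation.Binary.PropositionalEquality as ≡
open ≡ using (_≡_; _≢_)
import Relation.Binary.Reasoning.Setoid as SetoidReasoning
open import Relation.Nullary.Decidable using (Dec; yes; no; does; dec-true; dec-false; toSum)
open import Relation.Nullary.Negation.Core using (¬_; contradiction)

-- The specialisation v₁ = y₁ is what makes a valley tractable. Its image has two distinguished
-- candidates, the largest missing value (record) and the start of the path ending at the valley
-- (least element of a cycle), and whether they coincide depends on the later positions; with v₁ =
-- y₁ only the second is visible. Elsewhere the two tests do not collide: a deficiency never closes
-- a cycle, since a value v < i is the end of its own path, and when i is a missing value only the
-- fixed point i closes one.
--
-- The obstacle is that the choices for a deficiency are weighted by rank within S, so a single S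
-- yields no factor depending on h alone. Summing over all S with h elements restores one, because a
-- larger set can be reached by inserting any of its elements, and these have all the ranks once
-- each.
--
-- Positions 2k-1 and 2k together make one step in t. At height 0 their level steps multiply to
-- (λzₒ)(λzₑ) = δ₁; at height h ≥ 1 the level factors multiply to α of index 2h; an ascent from h
-- paired with the descent back gives α of index 2h+1.

module FiniteSums {c ℓ : Level} (R : CommutativeRing c ℓ) where
  open CommutativeRing R hiding (zero)
  open Series R
  open SetoidReasoning setoid
  open CSG +-commutativeSemigroup using () renaming (interchange to +-interchange)

  Σ< : ℕ → (ℕ → Carrier) → Carrier
  Σ< zero    f = 0#
  Σ< (suc n) f = f 0 + Σ< n (f ∘ suc)

  sumL-upTo : ∀ f n → sumL (map f (upTo n)) ≡ Σ< n f
  sumL-upTo f n = ≡.trans (≡.cong sumL (map-upTo f n)) (go f n)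
    where
    go : ∀ f n → sumL (applyUpTo f n) ≡ Σ< n f
    go f zero    = ≡.refl
    go f (suc n) = ≡.cong (f 0 +_) (go (f ∘ suc) n)

  Σ-cong< : ∀ n {f g} → (∀ i → i < n → f i ≈ g i) → Σ< n f ≈ Σ< n g
  Σ-cong< zero    e = refl
  Σ-cong< (suc n) e = +-cong (e 0 (s≤s z≤n)) (Σ-cong< n (λ i i<n → e (suc i) (s≤s i<n)))

  Σ-cong : ∀ n {f g} → (∀ i → f i ≈ g i) → Σ< n f ≈ Σ< n g
  Σ-cong n e = Σ-cong< n (λ i _ → e i)

  Σ-zero : ∀ n {f} → (∀ i → i < n → f i ≈ 0#) → Σ< n f ≈ 0#
  Σ-zero zero    e = refl
  Σ-zero (suc n) e =
    trans (+-cong (e 0 (s≤s z≤n)) (Σ-zero n (λ i i<n → e (suc i) (s≤s i<n)))) (+-identityˡ 0#)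

  Σ-+ : ∀ n f g → Σ< n (λ i → f i + g i) ≈ Σ< n f + Σ< n g
  Σ-+ zero    f g = sym (+-identityˡ 0#)
  Σ-+ (suc n) f g = trans (+-congˡ (Σ-+ n (f ∘ suc) (g ∘ suc))) (+-interchange _ _ _ _)

  Σ-*ˡ : ∀ n a f → Σ< n (λ i → a * f i) ≈ a * Σ< n f
  Σ-*ˡ zero    a f = sym (zeroʳ a)
  Σ-*ˡ (suc n) a f = trans (+-congˡ (Σ-*ˡ n a (f ∘ suc))) (sym (distribˡ a _ _))

  Σ-*ʳ : ∀ n a f → Σ< n (λ i → f i * a) ≈ Σ< n f * a
  Σ-*ʳ n a f = trans (Σ-cong n (λ i → *-comm (f i) a)) (trans (Σ-*ˡ n a f) (*-comm a _))

  Σ-last : ∀ n f → Σ< (suc n) f ≈ Σ< n f + f n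
  Σ-last zero    f = +-comm (f 0) 0#
  Σ-last (suc n) f = trans (+-congˡ (Σ-last n (f ∘ suc))) (sym (+-assoc _ _ _))

  Σ-truncate : ∀ {m n} f → m ≤ n → (∀ i → m ≤ i → f i ≈ 0#) → Σ< n f ≈ Σ< m f
  Σ-truncate {n = n} f z≤n     e = Σ-zero n (λ i _ → e i z≤n)
  Σ-truncate f (s≤s m≤n) e = +-congˡ (Σ-truncate (f ∘ suc) m≤n (λ i m≤i → e (suc i) (s≤s m≤i)))

-- Power series: the Cauchy product and the geometric series.

module PowerSeries {c ℓ : Level} (R : CommutativeRing c ℓ) where
  open CommutativeRing R hiding (zero)
  open Series R
  open FiniteSums R
  open SetoidReasoning setoid
  open Solver commutativeSemiring using (solve; _:=_; _:+_; _:*_; con)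

  infix 4 _≋_
  _≋_ : PS → PS → Set ℓ
  f ≋ g = ∀ n → f n ≈ g n

  infixl 6 _⊞_
  _⊞_ : PS → PS → PS
  (f ⊞ g) n = f n + g n

  infixr 7 _·_
  _·_ : Carrier → PS → PS
  (a · f) n = a * f n

  infixl 7 _⋆_
  -- The Cauchy product, peeled one coefficient of `f` at a time. Unlike `⊛` it involves no `n ∸ k`,
  -- so its laws go by induction on the index with `f ∘ suc` in place of `f`.
  _⋆_ : PS → PS → PS
  (f ⋆ g) zero    = f 0 * g 0
  (f ⋆ g) (suc n) = f 0 * g (suc n) + ((f ∘ suc) ⋆ g) n

  ⊛≋⋆ : ∀ f g → f ⊛ g ≋ f ⋆ g
  ⊛≋⋆ f g n = trans (reflexive (sumL-upTo (λ k → f k * g (n ∸ k)) (suc n))) (go f n)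
    where
    go : ∀ f n → Σ< (suc n) (λ k → f k * g (n ∸ k)) ≈ (f ⋆ g) n
    go f zero    = +-identityʳ _
    go f (suc n) = +-congˡ (go (f ∘ suc) n)

  ⋆-cong≤ : ∀ n {f f′ g g′} → (∀ k → k ≤ n → f k ≈ f′ k) → (∀ k → k ≤ n → g k ≈ g′ k) →
            (f ⋆ g) n ≈ (f′ ⋆ g′) n
  ⋆-cong≤ zero    ef eg = *-cong (ef 0 z≤n) (eg 0 z≤n)
  ⋆-cong≤ (suc n) ef eg = +-cong (*-cong (ef 0 z≤n) (eg (suc n) ℕₚ.≤-refl))
    (⋆-cong≤ n (λ k k≤n → ef (suc k) (s≤s k≤n)) (λ k k≤n → eg k (ℕₚ.m≤n⇒m≤1+n k≤n)))

  ⋆-cong : ∀ {f f′ g g′} → f ≋ f′ → g ≋ g′ → f ⋆ g ≋ f′ ⋆ g′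
  ⋆-cong ef eg n = ⋆-cong≤ n (λ k _ → ef k) (λ k _ → eg k)

  ⋆-zeroˡ : ∀ g n → ((λ _ → 0#) ⋆ g) n ≈ 0#
  ⋆-zeroˡ g zero    = zeroˡ _
  ⋆-zeroˡ g (suc n) = trans (+-cong (zeroˡ _) (⋆-zeroˡ g n)) (+-identityˡ 0#)

  ⋆-distribʳ : ∀ f f′ g → (f ⊞ f′) ⋆ g ≋ f ⋆ g ⊞ f′ ⋆ g
  ⋆-distribʳ f f′ g zero    = distribʳ _ _ _
  ⋆-distribʳ f f′ g (suc n) = trans (+-congˡ (⋆-distribʳ (f ∘ suc) (f′ ∘ suc) g n))
    (solve 5 (λ a b d x y → (a :+ b) :* d :+ (x :+ y) := (a :* d :+ x) :+ (b :* d :+ y)) refl _ _ _ _ _)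

  ·-⋆-assoc : ∀ a f g → (a · f) ⋆ g ≋ a · (f ⋆ g)
  ·-⋆-assoc a f g zero    = *-assoc _ _ _
  ·-⋆-assoc a f g (suc n) = trans (+-cong (*-assoc _ _ _) (·-⋆-assoc a (f ∘ suc) g n)) (sym (distribˡ _ _ _))

  ⋆-assoc : ∀ f g h → (f ⋆ g) ⋆ h ≋ f ⋆ (g ⋆ h)
  ⋆-assoc f g h zero    = *-assoc _ _ _
  ⋆-assoc f g h (suc n) = begin
    f 0 * g 0 * h (suc n) + ((λ m → f 0 * g (suc m) + ((f ∘ suc) ⋆ g) m) ⋆ h) n
      ≈⟨ +-congˡ (⋆-distribʳ (f 0 · (g ∘ suc)) ((f ∘ suc) ⋆ g) h n) ⟩
    f 0 * g 0 * h (suc n) + (((f 0 · (g ∘ suc)) ⋆ h) n + (((f ∘ suc) ⋆ g) ⋆ h) n)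
      ≈⟨ +-congˡ (+-cong (·-⋆-assoc (f 0) (g ∘ suc) h n) (⋆-assoc (f ∘ suc) g h n)) ⟩
    f 0 * g 0 * h (suc n) + (f 0 * ((g ∘ suc) ⋆ h) n + ((f ∘ suc) ⋆ (g ⋆ h)) n)
      ≈⟨ solve 5 (λ a b d x y → a :* b :* d :+ (a :* x :+ y) := a :* (b :* d :+ x) :+ y) refl _ _ _ _ _ ⟩
    f 0 * (g 0 * h (suc n) + ((g ∘ suc) ⋆ h) n) + ((f ∘ suc) ⋆ (g ⋆ h)) n ∎

  ⋆-sucʳ : ∀ f g n → (f ⋆ g) (suc n) ≈ f (suc n) * g 0 + (f ⋆ (g ∘ suc)) n
  ⋆-sucʳ f g zero    = +-comm _ _
  ⋆-sucʳ f g (suc n) = trans (+-congˡ (⋆-sucʳ (f ∘ suc) g n))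
    (solve 3 (λ x y z → x :+ (y :+ z) := y :+ (x :+ z)) refl _ _ _)

  ⋆-comm : ∀ f g → f ⋆ g ≋ g ⋆ f
  ⋆-comm f g zero    = *-comm _ _
  ⋆-comm f g (suc n) = trans (+-cong (*-comm _ _) (⋆-comm (f ∘ suc) g n)) (sym (⋆-sucʳ g f n))

  ⋆-identityˡ : ∀ g → oneS ⋆ g ≋ g
  ⋆-identityˡ g zero    = *-identityˡ _
  ⋆-identityˡ g (suc n) = trans (+-cong (*-identityˡ _) (⋆-zeroˡ g n)) (+-identityʳ _)

  tS-⋆ : ∀ f g → tS f ⋆ g ≋ tS (f ⋆ g)
  tS-⋆ f g zero    = zeroˡ _
  tS-⋆ f g (suc n) = trans (+-congʳ (zeroˡ _)) (+-identityˡ _)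

  tS-cong : ∀ {f g} → f ≋ g → tS f ≋ tS g
  tS-cong e zero    = refl
  tS-cong e (suc n) = e n

  ⋆-Σ : ∀ (g : PS) (p : ℕ → PS) N n → (g ⋆ (λ l → Σ< N (λ j → p j l))) n ≈ Σ< N (λ j → (g ⋆ p j) n)
  ⋆-Σ g p N zero    = sym (Σ-*ˡ N (g 0) (λ j → p j 0))
  ⋆-Σ g p N (suc n) = begin
    g 0 * Σ< N (λ j → p j (suc n)) + ((g ∘ suc) ⋆ (λ l → Σ< N (λ j → p j l))) n
      ≈⟨ +-cong (sym (Σ-*ˡ N (g 0) (λ j → p j (suc n)))) (⋆-Σ (g ∘ suc) p N n) ⟩
    Σ< N (λ j → g 0 * p j (suc n)) + Σ< N (λ j → ((g ∘ suc) ⋆ p j) n)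
      ≈⟨ Σ-+ N _ _ ⟨
    Σ< N (λ j → (g ⋆ p j) (suc n)) ∎

  powS-tS-suc : ∀ g j → powS (tS g) (suc j) ≋ tS (g ⋆ powS (tS g) j)
  powS-tS-suc g j n = trans (⊛≋⋆ (tS g) (powS (tS g) j) n) (tS-⋆ g (powS (tS g) j) n)

  powS-tS-order : ∀ g j l → l < j → powS (tS g) j l ≈ 0#
  powS-tS-order g (suc j) zero    _         = powS-tS-suc g j 0
  powS-tS-order g (suc j) (suc l) (s≤s l<j) = trans (powS-tS-suc g j (suc l))
    (trans (⋆-comm g (powS (tS g) j) l)
    (trans (⋆-cong≤ l (λ k k≤l → powS-tS-order g j k (ℕₚ.≤-<-trans k≤l l<j)) (λ _ _ → refl))
           (⋆-zeroˡ g l)))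

  geomT-Σ : ∀ g n → geomT g n ≈ Σ< (suc n) (λ j → powS (tS g) j n)
  geomT-Σ g n = reflexive (sumL-upTo (λ j → powS (tS g) j n) (suc n))

  geomT-unfold : ∀ g → geomT g ≋ oneS ⊞ tS (g ⋆ geomT g)
  geomT-unfold g zero    = geomT-Σ g 0
  geomT-unfold g (suc n) = trans (geomT-Σ g (suc n)) (+-congˡ (begin
    Σ< (suc n) (λ j → powS (tS g) (suc j) (suc n))
      ≈⟨ Σ-cong (suc n) (λ j → powS-tS-suc g j (suc n)) ⟩
    Σ< (suc n) (λ j → (g ⋆ powS (tS g) j) n)
      ≈⟨ ⋆-Σ g (powS (tS g)) (suc n) n ⟨
    (g ⋆ (λ l → Σ< (suc n) (λ j → powS (tS g) j l))) n
      -- `geomT` cuts its sum at its own index l, here the cut is at n; the terms in between have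
      -- order greater than l and vanish there.
      ≈⟨ ⋆-cong≤ n (λ _ _ → refl) (λ l l≤n →
           trans (Σ-truncate (λ j → powS (tS g) j l) (s≤s l≤n) (λ j → powS-tS-order g j l))
                 (sym (geomT-Σ g l))) ⟩
    (g ⋆ geomT g) n ∎))

-- Products of consecutive tails of the continued fraction.

module ContinuedFraction {c ℓ : Level} (R : CommutativeRing c ℓ)
    (x₁ x₂ y₁ y₂ u₁ u₂ v₂ wₑ wₒ zₑ zₒ λ' : CommutativeRing.Carrier R) where
  open CommutativeRing R hiding (zero)
  open Series R
  open CF x₁ x₂ y₁ y₂ u₁ u₂ v₂ wₑ wₒ zₑ zₒ λ'
  open PowerSeries R
  open SetoidReasoning setoid

  J-unfold : ∀ i d → J i (suc d) ≋ oneS ⊞ tS (δI i · J i (suc d) ⊞ αI i · (J (suc i) d ⋆ J i (suc d)))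
  J-unfold i d n = trans (geomT-unfold g n) (+-congˡ (tS-cong expand n))
    where
    g : PS
    g = δI i · oneS ⊞ αI i · J (suc i) d
    expand : g ⋆ J i (suc d) ≋ δI i · J i (suc d) ⊞ αI i · (J (suc i) d ⋆ J i (suc d))
    expand m = trans (⋆-distribʳ (δI i · oneS) (αI i · J (suc i) d) (J i (suc d)) m) (+-cong
      (trans (·-⋆-assoc (δI i) oneS (J i (suc d)) m) (*-congˡ (⋆-identityˡ (J i (suc d)) m)))
      (·-⋆-assoc (αI i) (J (suc i) d) (J i (suc d)) m))

  J-constant : ∀ i d → J i d 0 ≈ 1#
  J-constant i zero    = refl
  J-constant i (suc d) = trans (J-unfold i d 0) (+-identityʳ 1#)

  -- Unfolding one tail produces a product of two tails; multiplied by all preceding tails this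
  -- becomes a linear recurrence in k. The depths decrease so that every factor is an actual tail of
  -- the same truncated fraction `J 0 N`.
  tailProduct : ℕ → ℕ → PS
  tailProduct N zero    = J 0 N
  tailProduct N (suc k) = tailProduct N k ⋆ J (suc k) (N ∸ suc k)

  tailProduct-constant : ∀ N k → tailProduct N k 0 ≈ 1#
  tailProduct-constant N zero    = J-constant 0 N
  tailProduct-constant N (suc k) =
    trans (*-cong (tailProduct-constant N k) (J-constant (suc k) (N ∸ suc k))) (*-identityˡ 1#)

  tailProduct-zero : ∀ N m → tailProduct (suc N) 0 (suc m) ≈
                             δI 0 * tailProduct (suc N) 0 m + αI 0 * tailProduct (suc N) 1 m
  tailProduct-zero N m = trans (J-unfold 0 N (suc m))
    (trans (+-identityˡ _) (+-congˡ (*-congˡ (⋆-comm (J 1 N) (J 0 (suc N)) m))))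

  tailProduct-suc : ∀ N k m → suc k < N → tailProduct N (suc k) (suc m) ≈
                    tailProduct N k (suc m) + αI (suc k) * tailProduct N (suc (suc k)) m
  -- The bound leaves at least one level in the last tail, which can then be unfolded.
  tailProduct-suc N k m k<N with N ∸ suc k | ℕₚ.+-∸-assoc 1 k<N
  ... | .(suc (N ∸ suc (suc k))) | ≡.refl = begin
    (P ⋆ Q) (suc m)
      ≈⟨ ⋆-comm P Q (suc m) ⟩
    (Q ⋆ P) (suc m)
      ≈⟨ ⋆-cong {g = P} (J-unfold (suc k) (N ∸ suc (suc k))) (λ _ → refl) (suc m) ⟩
    ((oneS ⊞ tS W) ⋆ P) (suc m)
      ≈⟨ ⋆-distribʳ oneS (tS W) P (suc m) ⟩
    (oneS ⋆ P) (suc m) + (tS W ⋆ P) (suc m)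
      ≈⟨ +-cong (⋆-identityˡ P (suc m)) (tS-⋆ W P (suc m)) ⟩
    P (suc m) + (W ⋆ P) m
      ≈⟨ +-congˡ (⋆-cong {f = W} {g = P} (λ l → trans (+-congʳ (zeroˡ (Q l))) (+-identityˡ _)) (λ _ → refl) m) ⟩
    P (suc m) + ((αI (suc k) · (Q′ ⋆ Q)) ⋆ P) m
      ≈⟨ +-congˡ (·-⋆-assoc (αI (suc k)) (Q′ ⋆ Q) P m) ⟩
    P (suc m) + αI (suc k) * ((Q′ ⋆ Q) ⋆ P) m
      ≈⟨ +-congˡ (*-congˡ (trans (⋆-assoc Q′ Q P m) (trans (⋆-comm Q′ (Q ⋆ P) m)
           (⋆-cong {g = Q′} (⋆-comm Q P) (λ _ → refl) m)))) ⟩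
    P (suc m) + αI (suc k) * ((P ⋆ Q) ⋆ Q′) m ∎
    where
    P Q Q′ W : PS
    P  = tailProduct N k
    Q  = J (suc k) (suc (N ∸ suc (suc k)))
    Q′ = J (suc (suc k)) (N ∸ suc (suc k))
    W  = 0# · Q ⊞ αI (suc k) · (Q′ ⋆ Q)

  -- tailCoeff k m is the coefficient of tᵐ in the product of the first k + 1 tails of the
  -- infinite fraction.
  tailCoeff : ℕ → PS
  tailCoeff k       zero    = 1#
  tailCoeff zero    (suc m) = δI 0 * tailCoeff 0 m + αI 0 * tailCoeff 1 m
  tailCoeff (suc k) (suc m) = tailCoeff k (suc m) + αI (suc k) * tailCoeff (suc (suc k)) m

  -- A tail cut after d levels is exact up to the coefficient of tᵈ, and the last factor, cut after
  -- N - k levels, is the least exact. The recurrences never increase k + m.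
  tailProduct-coeff : ∀ N k m → k ℕ.+ m ≤ N → tailProduct N k m ≈ tailCoeff k m
  tailProduct-coeff N       k       zero    _ = tailProduct-constant N k
  tailProduct-coeff (suc N) zero    (suc m) p = trans (tailProduct-zero N m)
    (+-cong (*-congˡ (tailProduct-coeff (suc N) 0 m (ℕₚ.≤-trans (ℕₚ.n≤1+n m) p)))
            (*-congˡ (tailProduct-coeff (suc N) 1 m p)))
  tailProduct-coeff N       (suc k) (suc m) p = trans (tailProduct-suc N k m (ℕₚ.≤-trans (s≤s (s≤s (ℕₚ.m≤m+n k m))) q))
    (+-cong (tailProduct-coeff N k (suc m) (ℕₚ.≤-trans (ℕₚ.n≤1+n _) p))
            (*-congˡ (tailProduct-coeff N (suc (suc k)) m q)))
    where
    q : suc (suc k) ℕ.+ m ≤ N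
    q = ≡.subst (_≤ N) (≡.cong suc (ℕₚ.+-suc k m)) p

  cfCoeff-tailCoeff : ∀ n N → n < N → cfCoeff N n ≈ tailCoeff 0 n
  cfCoeff-tailCoeff n N n<N = tailProduct-coeff N 0 n (ℕₚ.<⇒≤ n<N)

-- Sums over the subsets of given cardinality.

card : ∀ {i} → Vec Bool i → ℕ
card []          = 0
card (true ∷ S)  = suc (card S)
card (false ∷ S) = card S

emptySubset : ∀ i → Vec Bool i
emptySubset zero    = []
emptySubset (suc i) = false ∷ emptySubset i

double : ℕ → ℕ
double zero    = zero
double (suc h) = suc (suc (double h))

n+n≡double : ∀ n → n ℕ.+ n ≡ double n
n+n≡double zero    = ≡.refl
n+n≡double (suc n) = ≡.cong suc (≡.trans (ℕₚ.+-suc n n) (≡.cong suc (n+n≡double n)))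

evenᵇ-double : ∀ n → evenᵇ (double n) ≡ true
evenᵇ-double zero    = ≡.refl
evenᵇ-double (suc n) rewrite evenᵇ-double n = ≡.refl

-- A subset S of {0,…,i-1} is a vector whose head tells whether i-1 ∈ S.
module SubsetSums {c ℓ : Level} (R : CommutativeRing c ℓ) where
  open CommutativeRing R hiding (zero)
  open Series R using (nat)
  open SetoidReasoning setoid
  open Solver commutativeSemiring using (solve; _:=_; _:+_; _:*_; con)

  sumCard : ∀ i → ℕ → (Vec Bool i → Carrier) → Carrier
  sumCard zero    zero    F = F []
  sumCard zero    (suc h) F = 0#
  sumCard (suc i) zero    F = sumCard i zero (F ∘ (false ∷_))
  sumCard (suc i) (suc h) F = sumCard i h (F ∘ (true ∷_)) + sumCard i (suc h) (F ∘ (false ∷_))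

  sumCard-+ : ∀ i h F G → sumCard i h (λ S → F S + G S) ≈ sumCard i h F + sumCard i h G
  sumCard-+ zero    zero    F G = refl
  sumCard-+ zero    (suc h) F G = sym (+-identityˡ 0#)
  sumCard-+ (suc i) zero    F G = sumCard-+ i zero (F ∘ (false ∷_)) (G ∘ (false ∷_))
  sumCard-+ (suc i) (suc h) F G =
    trans (+-cong (sumCard-+ i h (F ∘ (true ∷_)) (G ∘ (true ∷_)))
                  (sumCard-+ i (suc h) (F ∘ (false ∷_)) (G ∘ (false ∷_))))
      (solve 4 (λ a b d e → (a :+ b) :+ (d :+ e) := (a :+ d) :+ (b :+ e)) refl _ _ _ _)

  sumCard-card : ∀ (φ : ℕ → Carrier) i h F →
                 sumCard i h (λ S → φ (card S) * F S) ≈ φ h * sumCard i h F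
  sumCard-card φ zero    zero    F = refl
  sumCard-card φ zero    (suc h) F = sym (zeroʳ _)
  sumCard-card φ (suc i) zero    F = sumCard-card φ i zero (F ∘ (false ∷_))
  sumCard-card φ (suc i) (suc h) F =
    trans (+-cong (sumCard-card (φ ∘ suc) i h (F ∘ (true ∷_)))
                  (sumCard-card φ i (suc h) (F ∘ (false ∷_))))
      (sym (distribˡ _ _ _))

  -- first x u r is the weight of the choice of rank r, and level x u h the total weight of
  -- the choices of ranks 0,…,h-1.
  first : Carrier → Carrier → ℕ → Carrier
  first x u zero    = x
  first x u (suc h) = u

  level : Carrier → Carrier → ℕ → Carrier
  level x u zero    = 0#
  level x u (suc h) = x + nat h * u

  -- The sum of `F` over all sets with one element more than S, weighted by the rank of the new
  -- element, the number of members of S below it. As the head stands for the largest element, this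
  -- rank is the cardinality of the rest of the vector.
  insertions : Carrier → Carrier → ∀ {i} → (Vec Bool i → Carrier) → Vec Bool i → Carrier
  insertions x u F []          = 0#
  insertions x u F (true ∷ S)  = insertions x u (F ∘ (true ∷_)) S
  insertions x u F (false ∷ S) =
    first x u (card S) * F (true ∷ S) + insertions x u (F ∘ (false ∷_)) S

  -- A set with h + 1 elements arises by inserting any of them, exactly once its least.
  sumCard-insertions : ∀ x u i h F →
    sumCard i h (insertions x u F) ≈ level x u (suc h) * sumCard i (suc h) F
  sumCard-insertions x u zero    zero    F = sym (zeroʳ _)
  sumCard-insertions x u zero    (suc h) F = sym (zeroʳ _)
  sumCard-insertions x u (suc i) zero    F = begin
    sumCard i zero (λ S → first x u (card S) * F (true ∷ S) + insertions x u (F ∘ (false ∷_)) S)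
      ≈⟨ sumCard-+ i zero (λ S → first x u (card S) * F (true ∷ S)) (insertions x u (F ∘ (false ∷_))) ⟩
    _ ≈⟨ +-cong (sumCard-card (first x u) i zero (F ∘ (true ∷_))) (sumCard-insertions x u i zero (F ∘ (false ∷_))) ⟩
    x * A + (x + 0# * u) * B
      ≈⟨ solve 4 (λ x u a b → x :* a :+ (x :+ con 0 :* u) :* b := (x :+ con 0 :* u) :* (a :+ b)) refl x u A B ⟩
    (x + 0# * u) * (A + B) ∎
    where
    A B : Carrier
    A = sumCard i zero (F ∘ (true ∷_))
    B = sumCard i 1 (F ∘ (false ∷_))
  sumCard-insertions x u (suc i) (suc h) F = begin
    sumCard i h (insertions x u (F ∘ (true ∷_))) +
      sumCard i (suc h) (λ S → first x u (card S) * F (true ∷ S) + insertions x u (F ∘ (false ∷_)) S)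
      ≈⟨ +-cong (sumCard-insertions x u i h (F ∘ (true ∷_)))
           (sumCard-+ i (suc h) (λ S → first x u (card S) * F (true ∷ S)) (insertions x u (F ∘ (false ∷_)))) ⟩
    _ ≈⟨ +-congˡ (+-cong (sumCard-card (first x u) i (suc h) (F ∘ (true ∷_)))
           (sumCard-insertions x u i (suc h) (F ∘ (false ∷_)))) ⟩
    -- `A` collects the sets containing the largest element. Either it was there before the
    -- insertion, or it is itself inserted, with rank `suc h` and weight u; the two coefficients add
    -- up to that of `B`.
    (x + nat h * u) * A + (u * A + (x + (1# + nat h) * u) * B)
      ≈⟨ solve 5 (λ x u n a b → (x :+ n :* u) :* a :+ (u :* a :+ (x :+ (con 1 :+ n) :* u) :* b)
             := (x :+ (con 1 :+ n) :* u) :* (a :+ b)) refl x u (nat h) A B ⟩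
    (x + (1# + nat h) * u) * (A + B) ∎
    where
    A B : Carrier
    A = sumCard i (suc h) (F ∘ (true ∷_))
    B = sumCard i (suc (suc h)) (F ∘ (false ∷_))

  sumCard-∅ : ∀ i F → sumCard i 0 F ≈ F (emptySubset i)
  sumCard-∅ zero    F = refl
  sumCard-∅ (suc i) F = sumCard-∅ i (F ∘ (false ∷_))

-- Weighted walks on heights and the tails of the fraction.

module Heights {c ℓ : Level} (R : CommutativeRing c ℓ)
    (x₁ x₂ y₁ y₂ u₁ u₂ v₂ wₑ wₒ zₑ zₒ λ' : CommutativeRing.Carrier R) where
  open CommutativeRing R hiding (zero)
  open Series R
  open CF x₁ x₂ y₁ y₂ u₁ u₂ v₂ wₑ wₒ zₑ zₒ λ'
  open PowerSeries R
  open SubsetSums R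
  open ContinuedFraction R x₁ x₂ y₁ y₂ u₁ u₂ v₂ wₑ wₒ zₑ zₒ λ' using (tailCoeff)
  open SetoidReasoning setoid
  open Solver commutativeSemiring using (solve; _:=_; _:+_; _:*_; con)

  valley oddLevel evenLevel : ℕ → Carrier
  valley h    = (λ' + nat h) * y₁
  oddLevel h  = level y₂ v₂ h + λ' * first zₒ wₒ h
  evenLevel h = level x₂ u₂ h + λ' * first zₑ wₑ h

  -- The total weight of the positions below i, given the set of values below i
  -- that are taken by the positions from i on.
  completion : ∀ i → Vec Bool i → Carrier
  completion zero    []      = 1#
  completion (suc i) (s ∷ S) =
    -- An even 0-based index is an odd integer, so an excedance or a fixed point, and takes no new
    -- value below i; an odd index may insert one. `s` tells whether the value i is taken by a later
    -- position.
    if evenᵇ i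
    then (if s then valley (card S) else oddLevel (card S)) * completion i S
    else (if s then insertions x₂ u₂ (completion i) S
               else λ' * first zₑ wₑ (card S) * completion i S + insertions x₁ u₁ (completion i) S)

  atHeight : ℕ → ℕ → Carrier
  atHeight i h = sumCard i h (completion i)

  atHeight-even-zero : ∀ i → evenᵇ i ≡ true → atHeight (suc i) 0 ≈ oddLevel 0 * atHeight i 0
  atHeight-even-zero i e rewrite e = sumCard-card oddLevel i 0 (completion i)

  atHeight-even-suc : ∀ i h → evenᵇ i ≡ true →
    atHeight (suc i) (suc h) ≈ valley h * atHeight i h + oddLevel (suc h) * atHeight i (suc h)
  atHeight-even-suc i h e rewrite e =
    +-cong (sumCard-card valley i h (completion i)) (sumCard-card oddLevel i (suc h) (completion i))

  atHeight-odd : ∀ i h → evenᵇ i ≡ false →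
    atHeight (suc i) h ≈ evenLevel h * atHeight i h + level x₁ u₁ (suc h) * atHeight i (suc h)
  atHeight-odd i zero e rewrite e = trans
    (sumCard-+ i 0 (λ S → λ' * first zₑ wₑ (card S) * completion i S) (insertions x₁ u₁ (completion i)))
    (+-cong (trans (sumCard-card (λ h → λ' * first zₑ wₑ h) i 0 (completion i)) (*-congʳ (sym (+-identityˡ _))))
            (sumCard-insertions x₁ u₁ i 0 (completion i)))
  atHeight-odd i (suc h) e rewrite e = trans
    (+-cong (sumCard-insertions x₂ u₂ i h (completion i)) (trans
      (sumCard-+ i (suc h) (λ S → λ' * first zₑ wₑ (card S) * completion i S) (insertions x₁ u₁ (completion i)))
      (+-cong (sumCard-card (λ h → λ' * first zₑ wₑ h) i (suc h) (completion i))
              (sumCard-insertions x₁ u₁ i (suc h) (completion i)))))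
    (trans (sym (+-assoc _ _ _)) (+-congʳ (sym (distribʳ _ _ _))))

  shift : ℕ → PS → PS
  shift zero    f = f
  shift (suc h) f = tS (shift h f)

  shift-tS : ∀ h f → shift h (tS f) ≋ shift (suc h) f
  shift-tS zero    f n = refl
  shift-tS (suc h) f n = tS-cong (shift-tS h f) n

  shift-cong : ∀ h {f g} → f ≋ g → shift h f ≋ shift h g
  shift-cong zero    e = e
  shift-cong (suc h) e = tS-cong (shift-cong h e)

  shift-linear : ∀ h f a g → shift h (f ⊞ a · g) ≋ shift h f ⊞ a · shift h g
  shift-linear zero    f a g n       = refl
  shift-linear (suc h) f a g zero    = sym (trans (+-identityˡ _) (zeroʳ a))
  shift-linear (suc h) f a g (suc n) = shift-linear h f a g n

  shift-step : ∀ h k → shift h (tailCoeff (suc k)) ≋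
               shift h (tailCoeff k) ⊞ αI (suc k) · shift (suc h) (tailCoeff (suc (suc k)))
  shift-step h k n = begin
    shift h (tailCoeff (suc k)) n
      ≈⟨ shift-cong h {g = tailCoeff k ⊞ αI (suc k) · tS (tailCoeff (suc (suc k)))} unfold n ⟩
    shift h (tailCoeff k ⊞ αI (suc k) · tS (tailCoeff (suc (suc k)))) n
      ≈⟨ shift-linear h (tailCoeff k) (αI (suc k)) (tS (tailCoeff (suc (suc k)))) n ⟩
    shift h (tailCoeff k) n + αI (suc k) * shift h (tS (tailCoeff (suc (suc k)))) n
      ≈⟨ +-congˡ (*-congˡ (shift-tS h (tailCoeff (suc (suc k))) n)) ⟩
    shift h (tailCoeff k) n + αI (suc k) * shift (suc h) (tailCoeff (suc (suc k))) n ∎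
    where
    unfold : tailCoeff (suc k) ≋ tailCoeff k ⊞ αI (suc k) · tS (tailCoeff (suc (suc k)))
    unfold zero    = sym (trans (+-congˡ (zeroʳ _)) (+-identityʳ 1#))
    unfold (suc m) = refl

  half-double : ∀ h → half (double h) ≡ h
  half-double zero    = ≡.refl
  half-double (suc h) = ≡.cong suc (half-double h)

  half-suc-double : ∀ h → half (suc (double h)) ≡ h
  half-suc-double zero    = ≡.refl
  half-suc-double (suc h) = ≡.cong suc (half-suc-double h)

  αI-double : ∀ h → αI (double h) ≈ valley h * level x₁ u₁ (suc h)
  αI-double h rewrite evenᵇ-double h | half-double h =
    solve 3 (λ a b y → a :* b :* y := a :* y :* b) refl _ _ _

  αI-suc-double : ∀ h → αI (suc (double h)) ≈ evenLevel (suc h) * oddLevel (suc h)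
  αI-suc-double h rewrite evenᵇ-double h | half-suc-double h = refl

  -- The weight of the only walk from 0 to h in h double steps: each is a `valley` step up followed
  -- by a level step at an even integer.
  ascent : ℕ → Carrier
  ascent zero    = 1#
  ascent (suc h) = ascent h * valley h * evenLevel (suc h)

  -- The generating function of the walks from height 0 to height h is, up to the
  -- factor ascent h tʰ, the product of the first 2h + 1 (or 2h + 2) tails.
  mutual
    atHeight-double : ∀ m h → atHeight (double m) h ≈ ascent h * shift h (tailCoeff (double h)) m
    atHeight-double zero    zero    = sym (*-identityˡ 1#)
    atHeight-double zero    (suc h) = sym (zeroʳ _)
    atHeight-double (suc m) zero    = begin
      atHeight (double (suc m)) 0
        ≈⟨ atHeight-odd (suc (double m)) 0 (≡.cong not (evenᵇ-double m)) ⟩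
      evenLevel 0 * atHeight (suc (double m)) 0 + level x₁ u₁ 1 * atHeight (suc (double m)) 1
        -- Height 0 after an odd number of steps has no series of its own. It is only reached from
        -- height 0, and the two level steps λ zₒ and λ zₑ merge into `δI 0`.
        ≈⟨ +-cong (*-congˡ (trans (atHeight-even-zero (double m) (evenᵇ-double m))
                                  (*-congˡ (atHeight-double m 0))))
                  (*-congˡ (atHeight-suc-double m 0)) ⟩
      evenLevel 0 * (oddLevel 0 * (1# * A)) + level x₁ u₁ 1 * (1# * valley 0 * B)
        ≈⟨ solve 7 (λ l ze zo x y a b →
              (con 0 :+ l :* ze) :* ((con 0 :+ l :* zo) :* (con 1 :* a)) :+ x :* (con 1 :* y :* b)
              := con 1 :* (l :* l :* ze :* zo :* a :+ y :* x :* b))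
             refl λ' zₑ zₒ (level x₁ u₁ 1) (valley 0) A B ⟩
      1# * (δI 0 * A + valley 0 * level x₁ u₁ 1 * B)
        ≈⟨ *-congˡ (+-congˡ (*-congʳ (αI-double 0))) ⟨
      1# * (δI 0 * A + αI 0 * B) ∎
      where
      A B : Carrier
      A = tailCoeff 0 m
      B = tailCoeff 1 m
    atHeight-double (suc m) (suc h) = begin
      atHeight (double (suc m)) (suc h)
        ≈⟨ atHeight-odd (suc (double m)) (suc h) (≡.cong not (evenᵇ-double m)) ⟩
      evenLevel (suc h) * atHeight (suc (double m)) (suc h) +
        level x₁ u₁ (suc (suc h)) * atHeight (suc (double m)) (suc (suc h))
        ≈⟨ +-cong (*-congˡ (atHeight-suc-double m h)) (*-congˡ (atHeight-suc-double m (suc h))) ⟩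
      evenLevel (suc h) * (ascent h * valley h * A) +
        level x₁ u₁ (suc (suc h)) * (ascent h * valley h * evenLevel (suc h) * valley (suc h) * B)
        ≈⟨ solve 7 (λ e s v x w a b → e :* (s :* v :* a) :+ x :* (s :* v :* e :* w :* b)
              := s :* v :* e :* (a :+ w :* x :* b)) refl
             (evenLevel (suc h)) (ascent h) (valley h) (level x₁ u₁ (suc (suc h))) (valley (suc h)) A B ⟩
      ascent (suc h) * (A + valley (suc h) * level x₁ u₁ (suc (suc h)) * B)
        ≈⟨ *-congˡ (+-congˡ (*-congʳ (αI-double (suc h)))) ⟨
      ascent (suc h) * (A + αI (double (suc h)) * B)
        ≈⟨ *-congˡ (shift-step h (suc (double h)) m) ⟨
      ascent (suc h) * shift h (tailCoeff (double (suc h))) m ∎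
      where
      A B : Carrier
      A = shift h (tailCoeff (suc (double h))) m
      B = shift (suc h) (tailCoeff (suc (double (suc h)))) m

    atHeight-suc-double : ∀ m h → atHeight (suc (double m)) (suc h) ≈
                          ascent h * valley h * shift h (tailCoeff (suc (double h))) m
    atHeight-suc-double m h = begin
      atHeight (suc (double m)) (suc h)
        ≈⟨ atHeight-even-suc (double m) h (evenᵇ-double m) ⟩
      valley h * atHeight (double m) h + oddLevel (suc h) * atHeight (double m) (suc h)
        ≈⟨ +-cong (*-congˡ (atHeight-double m h)) (*-congˡ (atHeight-double m (suc h))) ⟩
      valley h * (ascent h * A) + oddLevel (suc h) * (ascent h * valley h * evenLevel (suc h) * B)
        ≈⟨ solve 6 (λ v s o e a b → v :* (s :* a) :+ o :* (s :* v :* e :* b) := s :* v :* (a :+ e :* o :* b))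
             refl (valley h) (ascent h) (oddLevel (suc h)) (evenLevel (suc h)) A B ⟩
      ascent h * valley h * (A + evenLevel (suc h) * oddLevel (suc h) * B)
        ≈⟨ *-congˡ (+-congˡ (*-congʳ (αI-suc-double h))) ⟨
      ascent h * valley h * (A + αI (suc (double h)) * B)
        ≈⟨ *-congˡ (shift-step h (double h) m) ⟨
      ascent h * valley h * shift h (tailCoeff (suc (double h))) m ∎
      where
      A B : Carrier
      A = shift h (tailCoeff (double h)) m
      B = shift (suc h) (tailCoeff (double (suc h))) m

  completion-∅ : ∀ n → completion (double n) (emptySubset (double n)) ≈ tailCoeff 0 n
  completion-∅ n = trans (sym (sumCard-∅ (double n) (completion (double n))))
    (trans (atHeight-double n 0) (*-identityˡ _))

-- The paths formed by the later positions, and the missing values.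

≡ᵇ-true : ∀ {m n} → m ≡ n → (m ≡ᵇ n) ≡ true
≡ᵇ-true {m} {n} = dec-true (m ≟ n)

≡ᵇ-false : ∀ {m n} → m ≢ n → (m ≡ᵇ n) ≡ false
≡ᵇ-false {m} {n} = dec-false (m ≟ n)

<ᵇ-true : ∀ {m n} → m < n → (m <ᵇ n) ≡ true
<ᵇ-true {m} {n} = dec-true (m <? n)

<ᵇ-false : ∀ {m n} → n ≤ m → (m <ᵇ n) ≡ false
<ᵇ-false {m} {n} n≤m = dec-false (m <? n) (ℕₚ.≤⇒≯ n≤m)

-- Tail M i T: T lists distinct images, all below M, of the positions i,…,M-1.
data Tail (M : ℕ) : ℕ → List ℕ → Set where
  []  : Tail M M []
  _∷_ : ∀ {i v T} → v < M × v ∉ T → Tail M (suc i) T → Tail M i (v ∷ T)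

tail-start : ∀ {M i T} → Tail M i T → i ≤ M
tail-start []      = ℕₚ.≤-refl
tail-start (_ ∷ t) = ℕₚ.<⇒≤ (tail-start t)

-- The edges j → T_j (j ≥ i) form paths; endpoint sends the start of a path, which is
-- a value missing from T, to its end, which is a position below i.
endpoint : ℕ → List ℕ → ℕ → ℕ
endpoint i []      u = u
endpoint i (v ∷ T) u =
  if endpoint (suc i) T u ≡ᵇ i then endpoint (suc i) T v else endpoint (suc i) T u

endpoint-through : ∀ v T u {i} → endpoint (suc i) T u ≡ i → endpoint i (v ∷ T) u ≡ endpoint (suc i) T v
endpoint-through v T u e rewrite ≡ᵇ-true e = ≡.refl

endpoint-avoid : ∀ v T u {i} → endpoint (suc i) T u ≢ i → endpoint i (v ∷ T) u ≡ endpoint (suc i) T u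
endpoint-avoid v T u e rewrite ≡ᵇ-false e = ≡.refl

-- No edge leaves a position below i yet, so a path starting there is trivial.
endpoint-low : ∀ i T {u} → u < i → endpoint i T u ≡ u
endpoint-low i []      u<i = ≡.refl
endpoint-low i (v ∷ T) {u} u<i with endpoint-low (suc i) T (ℕₚ.m<n⇒m<1+n u<i)
... | e = ≡.trans (endpoint-avoid v T u (λ e′ → ℕₚ.<⇒≢ u<i (≡.trans (≡.sym e) e′))) e

-- The edge i → v only prolongs the path that ended at i. Its new end is shared with no start but v
-- itself, and v is no longer missing.
endpoint-injective : ∀ {M i T u u′} → Tail M i T → u ∉ T → u′ ∉ T →
                     endpoint i T u ≡ endpoint i T u′ → u ≡ u′
endpoint-injective []      _   _    e = e
endpoint-injective {i = i} {v ∷ T} {u} {u′} (_ ∷ t) u∉ u′∉ e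
  with endpoint (suc i) T u ≟ i | endpoint (suc i) T u′ ≟ i
... | yes p | yes q = endpoint-injective t (u∉ ∘ there) (u′∉ ∘ there) (≡.trans p (≡.sym q))
... | no  p | no  q = endpoint-injective t (u∉ ∘ there) (u′∉ ∘ there)
      (≡.trans (≡.sym (endpoint-avoid v T u p)) (≡.trans e (endpoint-avoid v T u′ q)))
endpoint-injective {i = i} {v ∷ T} {u} {u′} ((_ , v∉T) ∷ t) u∉ u′∉ e | yes p | no  q =
  contradiction (here (≡.sym (endpoint-injective t v∉T (u′∉ ∘ there)
    (≡.trans (≡.sym (endpoint-through v T u p)) (≡.trans e (endpoint-avoid v T u′ q)))))) u′∉
endpoint-injective {i = i} {v ∷ T} {u} {u′} ((_ , v∉T) ∷ t) u∉ u′∉ e | no  p | yes q =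
  contradiction (here (endpoint-injective t (u∉ ∘ there) v∉T
    (≡.trans (≡.sym (endpoint-avoid v T u p)) (≡.trans e (endpoint-through v T u′ q))))) u∉

endpoint-< : ∀ {M i T u} → Tail M i T → u < M → u ∉ T → endpoint i T u < i
endpoint-< []      u<M u∉ = u<M
endpoint-< {i = i} {v ∷ T} {u} ((v<M , v∉T) ∷ t) u<M u∉ with endpoint (suc i) T u ≟ i
-- The path goes on as that of v, which does not end at i: otherwise u and v would share the end i.
... | yes p rewrite endpoint-through v T u p =
  ℕₚ.≤∧≢⇒< (ℕₚ.≤-pred (endpoint-< t v<M v∉T))
    (λ q → u∉ (here (endpoint-injective t (u∉ ∘ there) v∉T (≡.trans p (≡.sym q)))))
... | no  p rewrite endpoint-avoid v T u p =
  ℕₚ.≤∧≢⇒< (ℕₚ.≤-pred (endpoint-< t u<M (u∉ ∘ there))) p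

endpoint-surjective : ∀ {M i T s} → Tail M i T → s < i → ∃ λ u → u < M × u ∉ T × endpoint i T u ≡ s
endpoint-surjective {s = s} [] s<i = s , s<i , (λ ()) , ≡.refl
endpoint-surjective {i = i} {v ∷ T} {s} (_ ∷ t) s<i
  with endpoint-surjective t (ℕₚ.m<n⇒m<1+n s<i)
... | u , u<M , u∉T , eu with u ≟ v
... | no u≢v = u , u<M , (λ { (here p) → u≢v p ; (there p) → u∉T p }) ,
      ≡.trans (endpoint-avoid v T u (λ e → ℕₚ.<⇒≢ s<i (≡.trans (≡.sym eu) e))) eu
-- The start found is the value now taken by i. The start w of the path ending at i replaces it.
... | yes ≡.refl with endpoint-surjective t (ℕₚ.n<1+n i)
... | w , w<M , w∉T , ew = w , w<M , (λ { (here p) → w≢u p ; (there p) → w∉T p }) ,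
      ≡.trans (endpoint-through u T w ew) eu
  where
  w≢u : w ≢ u
  w≢u ≡.refl = ℕₚ.<⇒≢ s<i (≡.trans (≡.sym eu) ew)

below : ∀ i → List ℕ → Vec Bool i
below zero    T = []
below (suc i) T = does (i ∈? T) ∷ below i T

below-cons-≥ : ∀ {i v} T → i ≤ v → below i (v ∷ T) ≡ below i T
below-cons-≥ {zero}  T i≤v = ≡.refl
below-cons-≥ {suc i} T i<v rewrite ≡ᵇ-false (ℕₚ.<⇒≢ i<v) =
  ≡.cong (does (i ∈? T) ∷_) (below-cons-≥ T (ℕₚ.<⇒≤ i<v))

below-[] : ∀ i → below i [] ≡ emptySubset i
below-[] zero    = ≡.refl
below-[] (suc i) = ≡.cong (false ∷_) (below-[] i)

card-below-cons-< : ∀ {i v} T → v < i → v ∉ T → card (below i (v ∷ T)) ≡ suc (card (below i T))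
card-below-cons-< {suc i} {v} T v<i v∉T with i ≟ v
... | yes ≡.refl rewrite dec-false (i ∈? T) v∉T | ≡ᵇ-true {i} ≡.refl =
  ≡.cong suc (≡.cong card (below-cons-≥ {i} T ℕₚ.≤-refl))
... | no i≢v rewrite ≡ᵇ-false i≢v with i ∈? T
...   | yes _ = ≡.cong suc (card-below-cons-< T (ℕₚ.≤∧≢⇒< (ℕₚ.≤-pred v<i) (i≢v ∘ ≡.sym)) v∉T)
...   | no  _ = card-below-cons-< T (ℕₚ.≤∧≢⇒< (ℕₚ.≤-pred v<i) (i≢v ∘ ≡.sym)) v∉T

card-below-zero : ∀ i T {u} → card (below i T) ≡ 0 → u < i → u ∉ T
card-below-zero (suc i) T {u} c u<i with i ∈? T
... | no i∉T with u ≟ i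
...   | yes ≡.refl = i∉T
...   | no u≢i = card-below-zero i T c (ℕₚ.≤∧≢⇒< (ℕₚ.≤-pred u<i) u≢i)

card-below-suc : ∀ i T {h} → card (below i T) ≡ suc h → ∃ λ u → u < i × u ∈ T
card-below-suc (suc i) T c with i ∈? T
... | yes i∈T = i , ℕₚ.≤-refl , i∈T
... | no _ with card-below-suc i T c
...   | u , u<i , u∈T = u , ℕₚ.m<n⇒m<1+n u<i , u∈T

record IsLargest (M : ℕ) (p : ℕ → Bool) (u : ℕ) : Set where
  constructor largest
  field
    bound   : u < M
    holds   : p u ≡ true
    maximal : ∀ w → u < w → w < M → p w ≡ false

findLargest : ∀ M p → (∀ u → u < M → p u ≡ false) ⊎ ∃ (IsLargest M p)
findLargest zero    p = inj₁ (λ _ ())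
findLargest (suc M) p with p M in eq
... | true = inj₂ (M , largest ℕₚ.≤-refl eq (λ w M<w w<sM → contradiction M<w (ℕₚ.≤⇒≯ (ℕₚ.≤-pred w<sM))))
... | false with findLargest M p
...   | inj₁ none = inj₁ f
  where
  f : ∀ u → u < suc M → p u ≡ false
  f u u<sM with u ≟ M
  ... | yes ≡.refl = eq
  ... | no u≢M = none u (ℕₚ.≤∧≢⇒< (ℕₚ.≤-pred u<sM) u≢M)
...   | inj₂ (u , largest b h m) = inj₂ (u , largest (ℕₚ.m<n⇒m<1+n b) h f)
  where
  f : ∀ w → u < w → w < suc M → p w ≡ false
  f w u<w w<sM with w ≟ M
  ... | yes ≡.refl = eq
  ... | no w≢M = m w u<w (ℕₚ.≤∧≢⇒< (ℕₚ.≤-pred w<sM) w≢M)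

allBelow : ℕ → (ℕ → Bool) → Bool
allBelow zero    p = true
allBelow (suc n) p = p n ∧ allBelow n p

allBelow-true : ∀ n p → (∀ i → i < n → p i ≡ true) → allBelow n p ≡ true
allBelow-true zero    p h = ≡.refl
allBelow-true (suc n) p h rewrite h n ℕₚ.≤-refl = allBelow-true n p (λ i i<n → h i (ℕₚ.m<n⇒m<1+n i<n))

allBelow-false : ∀ n p {i} → i < n → p i ≡ false → allBelow n p ≡ false
allBelow-false (suc n) p {i} i<n h with i ≟ n
... | yes ≡.refl rewrite h = ≡.refl
... | no i≢n with p n
...   | true  = allBelow-false n p (ℕₚ.≤∧≢⇒< (ℕₚ.≤-pred i<n) i≢n) h
...   | false = ≡.refl

maximalMissing : ℕ → List ℕ → ℕ → Bool
maximalMissing M T v = allBelow M (λ u → not (v <ᵇ u) ∨ does (u ∈? T))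

isOpen : ℕ → List ℕ → ℕ → Bool
isOpen i T u = not (u <ᵇ i) ∧ not (does (u ∈? T))

isOpen-true : ∀ {i T u} → i ≤ u → u ∉ T → isOpen i T u ≡ true
isOpen-true {i} {T} {u} i≤u u∉T rewrite <ᵇ-false i≤u | dec-false (u ∈? T) u∉T = ≡.refl

isOpen-low : ∀ {i T u} → u < i → isOpen i T u ≡ false
isOpen-low u<i rewrite <ᵇ-true u<i = ≡.refl

isOpen-∈ : ∀ {i T u} → u ∈ T → isOpen i T u ≡ false
isOpen-∈ {i} {T} {u} u∈T rewrite dec-true (u ∈? T) u∈T with u <ᵇ i
... | true  = ≡.refl
... | false = ≡.refl

isOpen⇒ : ∀ i T {u} → isOpen i T u ≡ true → i ≤ u × u ∉ T
isOpen⇒ i T {u} o with u <? i | u ∈? T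
... | no u≮i | no u∉T = ℕₚ.≮⇒≥ u≮i , u∉T
... | yes u<i | _ rewrite <ᵇ-true u<i with () ← o
... | no u≮i | yes u∈T rewrite <ᵇ-false (ℕₚ.≮⇒≥ u≮i) with () ← o

-- A missing value above an open one is open too, so the largest open value is the largest missing
-- value.
maximalMissing-largest : ∀ M i T {u v} → IsLargest M (isOpen i T) u → isOpen i T v ≡ true → v < M →
                         maximalMissing M T v ≡ (v ≡ᵇ u)
maximalMissing-largest M i T {u} {v} (largest u<M ou mx) ov v<M with v ≟ u
... | yes ≡.refl rewrite ≡ᵇ-true {u} ≡.refl = allBelow-true M _ ok
  where
  ok : ∀ w → w < M → not (u <ᵇ w) ∨ does (w ∈? T) ≡ true
  ok w w<M with u <? w
  ... | no u≮w rewrite <ᵇ-false (ℕₚ.≮⇒≥ u≮w) = ≡.refl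
  ... | yes u<w rewrite <ᵇ-true u<w with w ∈? T
  ...   | yes w∈T = ≡.refl
  ...   | no w∉T with () ← ≡.trans (≡.sym (mx w u<w w<M))
                    (isOpen-true (ℕₚ.≤-trans (proj₁ (isOpen⇒ i T ou)) (ℕₚ.<⇒≤ u<w)) w∉T)
... | no v≢u rewrite ≡ᵇ-false v≢u = allBelow-false M _ u<M bad
  where
  v<u : v < u
  v<u with ℕₚ.<-cmp v u
  ... | tri< p _ _ = p
  ... | tri≈ _ p _ = contradiction p v≢u
  ... | tri> _ _ p with () ← ≡.trans (≡.sym ov) (mx v p v<M)
  bad : not (v <ᵇ u) ∨ does (u ∈? T) ≡ false
  bad rewrite <ᵇ-true v<u | dec-false (u ∈? T) (proj₂ (isOpen⇒ i T ou)) = ≡.refl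

vals : ∀ {M k} → Vec (Fin M) k → List ℕ
vals []      = []
vals (v ∷ T) = toℕ v ∷ vals T

-- A taken value s < i is, as a position, the end of some path. The start is not below i: it would
-- be its own end s, which is not missing.
open-exists : ∀ {M i T h} → Tail M i T → card (below i T) ≡ suc h →
              ∃ λ u → u < M × isOpen i T u ≡ true
open-exists {i = i} {T} t c with card-below-suc i T c
... | s , s<i , s∈T with endpoint-surjective t s<i
...   | u , u<M , u∉T , eu with u <? i
...     | no u≮i = u , u<M , isOpen-true (ℕₚ.≮⇒≥ u≮i) u∉T
...     | yes u<i with ≡.refl ← ≡.trans (≡.sym (endpoint-low i T u<i)) eu = contradiction s∈T u∉T

-- If u were missing, the end e < i of its path would as a value be missing too and be its own end;
-- injectivity would give u = e < i.
none-open : ∀ {M i T u} → Tail M i T → card (below i T) ≡ 0 → i ≤ u → u < M → u ∈ T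
none-open {i = i} {T} {u} t c i≤u u<M with u ∈? T
... | yes u∈T = u∈T
... | no u∉T = contradiction e<i (≡.subst (λ x → ¬ x < i) u≡e (ℕₚ.≤⇒≯ i≤u))
  where
  e<i : endpoint i T u < i
  e<i = endpoint-< t u<M u∉T
  u≡e : u ≡ endpoint i T u
  u≡e = endpoint-injective t u∉T (card-below-zero i T c e<i) (≡.sym (endpoint-low i T e<i))

-- A missing i is itself the start of the path ending at i.
closing-unique : ∀ {M i T v} → Tail M (suc i) T → i ∉ T → v ∉ T → endpoint (suc i) T v ≡ i → v ≡ i
closing-unique {i = i} {T} t i∉T v∉T e =
  endpoint-injective t v∉T i∉T (≡.trans e (≡.sym (endpoint-low (suc i) T ℕₚ.≤-refl)))

-- Counting missing values; sums over vectors.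

module ListSums {c ℓ : Level} (R : CommutativeRing c ℓ) where
  open CommutativeRing R hiding (zero)
  open Series R using (sumL; nat)
  open FiniteSums R
  open SetoidReasoning setoid
  open Solver commutativeSemiring using (solve; _:=_; _:+_; _:*_; con)

  -- Exchange of the one term at `u`, written without subtraction; in each use the surplus term is
  -- zero or is cancelled.
  Σ-update : ∀ M f g {u} → u < M → (∀ v → v ≢ u → f v ≈ g v) → Σ< M f + g u ≈ Σ< M g + f u
  Σ-update (suc M) f g {zero}  _         e = trans (+-congʳ (+-congˡ (Σ-cong M (λ v → e (suc v) (λ ())))))
    (solve 3 (λ a b s → a :+ s :+ b := b :+ s :+ a) refl _ _ _)
  Σ-update (suc M) f g {suc u} (s≤s u<M) e = begin
    f 0 + Σ< M (f ∘ suc) + g (suc u)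
      ≈⟨ +-assoc _ _ _ ⟩
    f 0 + (Σ< M (f ∘ suc) + g (suc u))
      ≈⟨ +-cong (e 0 (λ ())) (Σ-update M (f ∘ suc) (g ∘ suc) u<M (λ v v≢u → e (suc v) (v≢u ∘ ℕₚ.suc-injective))) ⟩
    g 0 + (Σ< M (g ∘ suc) + f (suc u))
      ≈⟨ +-assoc _ _ _ ⟨
    g 0 + Σ< M (g ∘ suc) + f (suc u) ∎

  [_] : Bool → Carrier
  [ b ] = if b then 1# else 0#

  -- The common source of the factors "one special choice and k ordinary ones": the closing choice
  -- of a valley, the record of a double rise. The number of choices is asked for in the ring, as
  -- `Σ-open` supplies it.
  Σ-distinguished : ∀ M (p q : ℕ → Bool) a b k {u} → u < M → p u ≡ true →
    (∀ v → v < M → p v ≡ true → q v ≡ (v ≡ᵇ u)) → Σ< M (λ v → [ p v ]) ≈ nat (suc k) →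
    Σ< M (λ v → if p v then (if q v then a else b) else 0#) ≈ a + nat k * b
  Σ-distinguished M p q a b k {u} u<M pu qv e =
    -- With b added, the special term can be exchanged for an ordinary one, which leaves k + 1 equal
    -- terms and the surplus a.
    GroupProperties.∙-cancelʳ +-group b _ _ (begin
      Σ< M f + b
        ≈⟨ +-cong (Σ-cong< M (λ v v<M → at v v<M)) (reflexive gu) ⟨
      Σ< M f′ + g u
        ≈⟨ Σ-update M f′ g u<M (λ v v≢u → reflexive (≡.cong (λ x → if p v then (if x then a else b) else 0#) (≡ᵇ-false v≢u))) ⟩
      Σ< M g + f′ u
        ≈⟨ +-cong (trans (Σ-cong M (λ v → split (p v))) (trans (Σ-*ʳ M b (λ v → [ p v ])) (*-congʳ e)))
                  (reflexive f′u) ⟩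
      (1# + nat k) * b + a
        ≈⟨ solve 3 (λ n b a → (con 1 :+ n) :* b :+ a := a :+ n :* b :+ b) refl (nat k) b a ⟩
      a + nat k * b + b ∎)
    where
    f f′ g : ℕ → Carrier
    f v  = if p v then (if q v then a else b) else 0#
    f′ v = if p v then (if v ≡ᵇ u then a else b) else 0#
    g v  = if p v then b else 0#
    at : ∀ v → v < M → f′ v ≈ f v
    at v v<M with p v in eq
    ... | true  = reflexive (≡.cong (λ x → if x then a else b) (≡.sym (qv v v<M eq)))
    ... | false = refl
    gu : g u ≡ b
    gu rewrite pu = ≡.refl
    f′u : f′ u ≡ a
    f′u rewrite pu | ≡ᵇ-true {u} ≡.refl = ≡.refl
    split : ∀ x → (if x then b else 0#) ≈ [ x ] * b
    split true  = sym (*-identityˡ b)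
    split false = sym (zeroˡ b)

  -- M - i positions take M - i distinct values, so each value taken below i leaves one missing at
  -- or above i. In the induction the threshold first drops from `suc i` to i (from `g` to `f`),
  -- then v is taken (from `f` to `h`).
  Σ-open : ∀ {M i T} → Tail M i T → Σ< M (λ u → [ isOpen i T u ]) ≈ nat (card (below i T))
  Σ-open {M} [] = trans (Σ-zero M (λ u u<M → reflexive (≡.cong [_] (isOpen-low {M} {[]} u<M))))
    (reflexive (≡.cong nat (≡.sym (≡.trans (≡.cong card (below-[] M)) (card-∅ M)))))
    where
    card-∅ : ∀ i → card (emptySubset i) ≡ 0
    card-∅ zero    = ≡.refl
    card-∅ (suc i) = card-∅ i
  Σ-open {M} {i} {v ∷ T} ((v<M , v∉T) ∷ t) = GroupProperties.∙-cancelʳ +-group 1# _ _ result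
    where
    f g : ℕ → Carrier
    f u = [ isOpen i T u ]
    g u = [ isOpen (suc i) T u ]
    f≈g : ∀ u → u ≢ i → f u ≈ g u
    f≈g u u≢i with ℕₚ.<-cmp u i
    ... | tri< u<i _ _ rewrite <ᵇ-true u<i | <ᵇ-true (ℕₚ.m<n⇒m<1+n u<i) = refl
    ... | tri≈ _ u≡i _ = contradiction u≡i u≢i
    ... | tri> u≮i _ i<u rewrite <ᵇ-false (ℕₚ.<⇒≤ i<u) | <ᵇ-false i<u = refl
    gi : g i ≡ 0#
    gi = ≡.cong [_] (isOpen-low {suc i} {T} ℕₚ.≤-refl)
    fi : nat (card (below (suc i) T)) + f i ≈ 1# + nat (card (below i T))
    fi rewrite <ᵇ-false (ℕₚ.≤-refl {i}) with does (i ∈? T)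
    ... | true  = +-identityʳ _
    ... | false = +-comm _ _
    Σf : Σ< M f ≈ 1# + nat (card (below i T))
    Σf = trans (sym (+-identityʳ _)) (trans (+-congˡ (reflexive (≡.sym gi)))
           (trans (Σ-update M f g (tail-start t) f≈g) (trans (+-congʳ (Σ-open t)) fi)))
    h : ℕ → Carrier
    h u = [ isOpen i (v ∷ T) u ]
    h≈f : ∀ u → u ≢ v → h u ≈ f u
    h≈f u u≢v rewrite ≡ᵇ-false u≢v = refl
    hv : h v ≡ 0#
    hv = ≡.cong [_] (isOpen-∈ {i} {v ∷ T} (here ≡.refl))
    result : Σ< M h + 1# ≈ nat (card (below i (v ∷ T))) + 1#
    result with v <? i
    ... | no v≮i = begin
      Σ< M h + 1#
        ≡⟨ ≡.cong (λ x → Σ< M h + [ x ]) (isOpen-true {i} {T} (ℕₚ.≮⇒≥ v≮i) v∉T) ⟨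
      Σ< M h + f v
        ≈⟨ Σ-update M h f v<M h≈f ⟩
      Σ< M f + h v
        ≈⟨ trans (+-cong Σf (reflexive hv)) (+-identityʳ _) ⟩
      1# + nat (card (below i T))
        ≈⟨ +-comm _ _ ⟩
      nat (card (below i T)) + 1#
        ≡⟨ ≡.cong (λ S → nat (card S) + 1#) (below-cons-≥ {i} T (ℕₚ.≮⇒≥ v≮i)) ⟨
      nat (card (below i (v ∷ T))) + 1# ∎
    ... | yes v<i = +-congʳ (begin
      Σ< M h
        ≈⟨ Σ-cong M (λ u → same u) ⟩
      Σ< M f
        ≈⟨ Σf ⟩
      nat (suc (card (below i T)))
        ≡⟨ ≡.cong nat (card-below-cons-< {i} T v<i v∉T) ⟨
      nat (card (below i (v ∷ T))) ∎)
      where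
      same : ∀ u → h u ≈ f u
      same u with u ≟ v
      ... | no u≢v = h≈f u u≢v
      ... | yes ≡.refl rewrite <ᵇ-true v<i = refl

  sumL-cong : ∀ {A : Set} {f g : A → Carrier} xs → (∀ x → f x ≈ g x) → sumL (map f xs) ≈ sumL (map g xs)
  sumL-cong []       e = refl
  sumL-cong (x ∷ xs) e = +-cong (e x) (sumL-cong xs e)

  sumL-++ : ∀ {A : Set} (f : A → Carrier) xs ys → sumL (map f (xs ++ ys)) ≈ sumL (map f xs) + sumL (map f ys)
  sumL-++ f []       ys = sym (+-identityˡ _)
  sumL-++ f (x ∷ xs) ys = trans (+-congˡ (sumL-++ f xs ys)) (sym (+-assoc _ _ _))

  sumL-+ : ∀ {A : Set} (f g : A → Carrier) xs → sumL (map (λ x → f x + g x) xs) ≈ sumL (map f xs) + sumL (map g xs)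
  sumL-+ f g []       = sym (+-identityˡ _)
  sumL-+ f g (x ∷ xs) = trans (+-congˡ (sumL-+ f g xs))
    (solve 4 (λ a b d e → a :+ b :+ (d :+ e) := a :+ d :+ (b :+ e)) refl _ _ _ _)

  -- `vecs` runs over the head first, but the weight of a head depends on its tail. The exchange
  -- lets the image of a position be summed with all later images fixed.
  sumL-vecs-suc : ∀ {M k} (f : Vec (Fin M) (suc k) → Carrier) →
    sumL (map f (vecs M (suc k))) ≈ sumL (map (λ T → sumL (map (λ v → f (v ∷ T)) (allFin M))) (vecs M k))
  sumL-vecs-suc {M} {k} f = outer (allFin M)
    where
    zeros : ∀ {A : Set} (xs : List A) → sumL (map (λ _ → 0#) xs) ≈ 0#
    zeros []       = refl
    zeros (x ∷ xs) = trans (+-identityˡ _) (zeros xs)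
    inner : ∀ v Ts → sumL (map f (map (v ∷_) Ts)) ≡ sumL (map (λ T → f (v ∷ T)) Ts)
    inner v []       = ≡.refl
    inner v (T ∷ Ts) = ≡.cong (f (v ∷ T) +_) (inner v Ts)
    outer : ∀ vs → sumL (map f (concatMap (λ v → map (v ∷_) (vecs M k)) vs)) ≈
                   sumL (map (λ T → sumL (map (λ v → f (v ∷ T)) vs)) (vecs M k))
    outer []       = sym (zeros (vecs M k))
    outer (v ∷ vs) = begin
      _ ≈⟨ sumL-++ f (map (v ∷_) (vecs M k)) _ ⟩
      _ ≈⟨ +-cong (reflexive (inner v (vecs M k))) (outer vs) ⟩
      _ ≈⟨ sumL-+ (λ T → f (v ∷ T)) (λ T → sumL (map (λ v → f (v ∷ T)) vs)) (vecs M k) ⟨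
      _ ∎

  sumL-allFin : ∀ M (f : ℕ → Carrier) → sumL (map (λ v → f (toℕ v)) (allFin M)) ≡ Σ< M f
  sumL-allFin M f = ≡.trans (≡.cong sumL (map-tabulate {n = M} id (f ∘ toℕ))) (go M f)
    where
    go : ∀ M (f : ℕ → Carrier) → sumL (tabulate {n = M} (f ∘ toℕ)) ≡ Σ< M f
    go zero    f = ≡.refl
    go (suc M) f = ≡.cong (f 0 +_) (go M (f ∘ suc))

if-cong : ∀ {a} {A : Set a} {b b′ : Bool} {x y : A} → b ≡ b′ →
          (if b then x else y) ≡ (if b′ then x else y)
if-cong ≡.refl = ≡.refl

-- Local weights, and their sum over the image of one position.

module LocalWeights {c ℓ : Level} (R : CommutativeRing c ℓ)
    (x₁ x₂ y₁ y₂ u₁ u₂ v₂ wₑ wₒ zₑ zₒ λ' : CommutativeRing.Carrier R) where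
  open CommutativeRing R hiding (zero)
  open Series R using (sumL; nat)
  open FiniteSums R
  open SubsetSums R
  open ListSums R
  open Heights R x₁ x₂ y₁ y₂ u₁ u₂ v₂ wₑ wₒ zₑ zₒ λ'
  open SetoidReasoning setoid

  closingWeight : ℕ → ℕ → List ℕ → Carrier
  closingWeight i v T = if endpoint (suc i) T v ≡ᵇ i then λ' else 1#

  -- In a permutation a fixed point i is a record, and equally an antirecord, exactly when no later
  -- position takes a value below i.
  fixedWeight : ℕ → List ℕ → Carrier
  fixedWeight i T =
    if evenᵇ i then first zₒ wₒ (card (below i T)) else first zₑ wₑ (card (below i T))

  -- A valley weighs y₁ whether or not it is a record: this is where v₁ = y₁ enters.
  excedanceWeight : ℕ → ℕ → ℕ → List ℕ → Carrier
  excedanceWeight M i v T =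
    if does (i ∈? T) then y₁ else (if maximalMissing M T v then y₂ else v₂)

  -- If i is in T, its preimage lies after i and the deficiency is a double fall; otherwise it is a
  -- peak.
  deficiencyWeight : ℕ → ℕ → List ℕ → Carrier
  deficiencyWeight i v T =
    if does (i ∈? T) then first x₂ u₂ (card (below v T)) else first x₁ u₁ (card (below v T))

  -- The zeros replace the filter of `Dperms`: a repeated value, or a direction that the parity of i
  -- forbids, kills the product, so the sum may run over all vectors.
  kindWeight localWeight : ℕ → ℕ → ℕ → List ℕ → Carrier
  kindWeight M i v T =
    if v ≡ᵇ i then fixedWeight i T
    else (if i <ᵇ v then (if evenᵇ i then excedanceWeight M i v T else 0#)
                    else (if evenᵇ i then 0# else deficiencyWeight i v T))
  localWeight M i v T = if does (v ∈? T) then 0# else closingWeight i v T * kindWeight M i v T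

  tailWeight : ℕ → ℕ → List ℕ → Carrier
  tailWeight M i []      = 1#
  tailWeight M i (v ∷ T) = localWeight M i v T * tailWeight M (suc i) T

  closing-through : ∀ i v T → endpoint (suc i) T v ≡ i → closingWeight i v T ≡ λ'
  closing-through i v T e rewrite ≡ᵇ-true e = ≡.refl

  closing-avoid : ∀ i v T → endpoint (suc i) T v ≢ i → closingWeight i v T ≡ 1#
  closing-avoid i v T e rewrite ≡ᵇ-false e = ≡.refl

  local-∈ : ∀ M i {v T} → v ∈ T → localWeight M i v T ≡ 0#
  local-∈ M i {v} {T} v∈T rewrite dec-true (v ∈? T) v∈T = ≡.refl

  local-∉ : ∀ M i {v T} → v ∉ T → localWeight M i v T ≡ closingWeight i v T * kindWeight M i v T
  local-∉ M i {v} {T} v∉T rewrite dec-false (v ∈? T) v∉T = ≡.refl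

  kind-fixed : ∀ M i T → kindWeight M i i T ≡ fixedWeight i T
  kind-fixed M i T rewrite ≡ᵇ-true {i} ≡.refl = ≡.refl

  kind-> : ∀ M {i v} T → i < v → kindWeight M i v T ≡ (if evenᵇ i then excedanceWeight M i v T else 0#)
  kind-> M T i<v rewrite ≡ᵇ-false (ℕₚ.>⇒≢ i<v) | <ᵇ-true i<v = ≡.refl

  kind-< : ∀ M {i v} T → v < i → kindWeight M i v T ≡ (if evenᵇ i then 0# else deficiencyWeight i v T)
  kind-< M T v<i rewrite ≡ᵇ-false (ℕₚ.<⇒≢ v<i) | <ᵇ-false (ℕₚ.<⇒≤ v<i) = ≡.refl

  local-fixed : ∀ M i {T} → i ∉ T → localWeight M i i T ≈ λ' * fixedWeight i T
  local-fixed M i {T} i∉T = reflexive (≡.trans (local-∉ M i i∉T)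
    (≡.cong₂ _*_ (closing-through i i T (endpoint-low (suc i) T ℕₚ.≤-refl)) (kind-fixed M i T)))

  local-low : ∀ M {i v T} → v < i → v ∉ T → evenᵇ i ≡ true → localWeight M i v T ≈ 0#
  local-low M {i} {v} {T} v<i v∉T e = trans (reflexive (local-∉ M i v∉T)) (trans
    (*-congˡ (reflexive (≡.trans (kind-< M T v<i) (if-cong e)))) (zeroʳ _))

  local-high : ∀ M {i v T} → i < v → v ∉ T → evenᵇ i ≡ false → localWeight M i v T ≈ 0#
  local-high M {i} {v} {T} i<v v∉T e = trans (reflexive (local-∉ M i v∉T)) (trans
    (*-congˡ (reflexive (≡.trans (kind-> M T i<v) (if-cong e)))) (zeroʳ _))

  local-excedance : ∀ M {i v T} → i < v → v ∉ T → evenᵇ i ≡ true →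
                    localWeight M i v T ≡ closingWeight i v T * excedanceWeight M i v T
  local-excedance M {i} {v} {T} i<v v∉T e = ≡.trans (local-∉ M i v∉T)
    (≡.cong (closingWeight i v T *_) (≡.trans (kind-> M T i<v) (if-cong e)))

  local-deficiency : ∀ M {i v T} → v < i → v ∉ T → evenᵇ i ≡ false →
                     localWeight M i v T ≈ deficiencyWeight i v T
  local-deficiency M {i} {v} {T} v<i v∉T e = trans (reflexive (local-∉ M i v∉T)) (trans
    (*-cong (reflexive (closing-avoid i v T (λ p → ℕₚ.<⇒≢ v<i
               (≡.trans (≡.sym (endpoint-low (suc i) T (ℕₚ.m<n⇒m<1+n v<i))) p))))
            (reflexive (≡.trans (kind-< M T v<i) (if-cong e))))
    (*-identityˡ _))

  -- Among the missing values above i, the start of the path ending at i gains λ. As i itself is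
  -- taken, there is one candidate more than `card (below i T)`.
  Σ-valley : ∀ {M i T} → Tail M (suc i) T → i ∈ T → evenᵇ i ≡ true →
             Σ< M (λ v → localWeight M i v T) ≈ valley (card (below i T))
  Σ-valley {M} {i} {T} t i∈T e with endpoint-surjective t ℕₚ.≤-refl
  ... | u , u<M , u∉T , eu = begin
    Σ< M (λ v → localWeight M i v T)
      ≈⟨ Σ-cong M pointwise ⟩
    Σ< M (λ v → if isOpen (suc i) T v then (if endpoint (suc i) T v ≡ᵇ i then λ' * y₁ else y₁) else 0#)
      ≈⟨ Σ-distinguished M (isOpen (suc i) T) (λ v → endpoint (suc i) T v ≡ᵇ i) (λ' * y₁) y₁
           (card (below i T)) u<M (isOpen-true i<u u∉T) unique count ⟩
    λ' * y₁ + nat (card (below i T)) * y₁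
      ≈⟨ distribʳ y₁ λ' _ ⟨
    valley (card (below i T)) ∎
    where
    -- A start not above i would be its own end, hence i; but i is taken.
    i<u : i < u
    i<u with u <? suc i
    ... | no u≮ = ℕₚ.≮⇒≥ u≮
    ... | yes u<si with ≡.refl ← ≡.trans (≡.sym (endpoint-low (suc i) T u<si)) eu = contradiction i∈T u∉T
    unique : ∀ v → v < M → isOpen (suc i) T v ≡ true → (endpoint (suc i) T v ≡ᵇ i) ≡ (v ≡ᵇ u)
    unique v v<M o with v ≟ u
    ... | yes ≡.refl rewrite ≡ᵇ-true eu | ≡ᵇ-true {u} ≡.refl = ≡.refl
    ... | no v≢u rewrite ≡ᵇ-false v≢u = ≡ᵇ-false (λ ev → v≢u
          (endpoint-injective t (proj₂ (isOpen⇒ (suc i) T o)) u∉T (≡.trans ev (≡.sym eu))))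
    count : Σ< M (λ v → [ isOpen (suc i) T v ]) ≈ nat (suc (card (below i T)))
    count = trans (Σ-open t) (reflexive (≡.cong (λ b → nat (card (b ∷ below i T))) (dec-true (i ∈? T) i∈T)))
    pointwise : ∀ v → localWeight M i v T ≈
      (if isOpen (suc i) T v then (if endpoint (suc i) T v ≡ᵇ i then λ' * y₁ else y₁) else 0#)
    pointwise v with toSum (v ∈? T)
    ... | inj₁ v∈T rewrite isOpen-∈ {suc i} v∈T = reflexive (local-∈ M i v∈T)
    ... | inj₂ v∉T with ℕₚ.<-cmp v i
    ...   | tri≈ _ ≡.refl _ = contradiction i∈T v∉T
    ...   | tri< v<i _ _ rewrite isOpen-low {suc i} {T} (ℕₚ.m<n⇒m<1+n v<i) = local-low M v<i v∉T e
    ...   | tri> _ _ i<v rewrite isOpen-true {suc i} {T} i<v v∉T =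
      trans (reflexive (local-excedance M i<v v∉T e)) (weight (endpoint (suc i) T v ≡ᵇ i))
      where
      weight : ∀ b → (if b then λ' else 1#) * excedanceWeight M i v T ≈ (if b then λ' * y₁ else y₁)
      weight b rewrite dec-true (i ∈? T) i∈T with b
      ... | true  = refl
      ... | false = *-identityˡ y₁

  Σ-rise : ∀ {M i T} → Tail M (suc i) T → i ∉ T →
           Σ< M (λ v → if isOpen (suc i) T v then (if maximalMissing M T v then y₂ else v₂) else 0#) ≈
           level y₂ v₂ (card (below i T))
  Σ-rise {M} {i} {T} t i∉T with card (below (suc i) T) in eq
  ... | zero rewrite dec-false (i ∈? T) i∉T | eq = Σ-zero M zeroAt
    where
    zeroAt : ∀ v → v < M → (if isOpen (suc i) T v then (if maximalMissing M T v then y₂ else v₂) else 0#) ≈ 0#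
    zeroAt v v<M with isOpen (suc i) T v in o
    ... | false = refl
    ... | true with isOpen⇒ (suc i) T o
    ...   | i<v , v∉T = contradiction (none-open t card-zero i<v v<M) v∉T
      where
      card-zero : card (below (suc i) T) ≡ 0
      card-zero rewrite dec-false (i ∈? T) i∉T = eq
  ... | suc h with open-exists t eq | findLargest M (isOpen (suc i) T)
  ...   | u , u<M , ou | inj₁ none with () ← ≡.trans (≡.sym ou) (none u u<M)
  ...   | _ | inj₂ (u , l@(largest u<M ou _)) = trans
    (Σ-distinguished M (isOpen (suc i) T) (maximalMissing M T) y₂ v₂ h u<M ou
      (λ v v<M ov → maximalMissing-largest M (suc i) T l ov v<M) (trans (Σ-open t) (reflexive (≡.cong nat eq))))
    (reflexive (≡.cong (level y₂ v₂) (≡.sym card-eq)))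
    where
    card-eq : card (below i T) ≡ suc h
    card-eq rewrite dec-false (i ∈? T) i∉T = eq

  -- With i missing, all proper excedances are double rises, and only the fixed point closes a
  -- cycle; so λ goes with the fixed point alone.
  Σ-oddLevel : ∀ {M i T} → Tail M (suc i) T → i ∉ T → evenᵇ i ≡ true →
               Σ< M (λ v → localWeight M i v T) ≈ oddLevel (card (below i T))
  Σ-oddLevel {M} {i} {T} t i∉T e = begin
    Σ< M (λ v → localWeight M i v T)
      ≈⟨ +-identityʳ _ ⟨
    Σ< M (λ v → localWeight M i v T) + 0#
      ≡⟨ ≡.cong (Σ< M (λ v → localWeight M i v T) +_) (if-cong (isOpen-low {suc i} {T} ℕₚ.≤-refl)) ⟨
    Σ< M (λ v → localWeight M i v T) + g i
      ≈⟨ Σ-update M (λ v → localWeight M i v T) g (tail-start t) pointwise ⟩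
    Σ< M g + localWeight M i i T
      ≈⟨ +-cong (Σ-rise t i∉T) (trans (local-fixed M i i∉T)
           (*-congˡ (reflexive (if-cong e)))) ⟩
    oddLevel (card (below i T)) ∎
    where
    g : ℕ → Carrier
    g v = if isOpen (suc i) T v then (if maximalMissing M T v then y₂ else v₂) else 0#
    pointwise : ∀ v → v ≢ i → localWeight M i v T ≈ g v
    pointwise v v≢i with toSum (v ∈? T)
    ... | inj₁ v∈T rewrite isOpen-∈ {suc i} v∈T = reflexive (local-∈ M i v∈T)
    ... | inj₂ v∉T with ℕₚ.<-cmp v i
    ...   | tri≈ _ v≡i _ = contradiction v≡i v≢i
    ...   | tri< v<i _ _ rewrite isOpen-low {suc i} {T} (ℕₚ.m<n⇒m<1+n v<i) = local-low M v<i v∉T e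
    ...   | tri> _ _ i<v rewrite isOpen-true {suc i} {T} i<v v∉T =
      trans (reflexive (local-excedance M i<v v∉T e)) (trans
        (*-cong (reflexive (closing-avoid i v T (λ p → v≢i (closing-unique t i∉T v∉T p))))
                (reflexive (if-cong (dec-false (i ∈? T) i∉T))))
        (*-identityˡ _))

  Σ-insertions : ∀ x u i T (F : Vec Bool i → Carrier) →
    Σ< i (λ v → if does (v ∈? T) then 0# else first x u (card (below v T)) * F (below i (v ∷ T))) ≈
    insertions x u F (below i T)
  Σ-insertions x u zero    T F = refl
  Σ-insertions x u (suc i) T F = trans (Σ-last i _) (trans
    (+-congʳ (trans (Σ-cong< i pointwise) (Σ-insertions x u i T (F ∘ (does (i ∈? T) ∷_))))) final)
    where
    pointwise : ∀ v → v < i →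
      (if does (v ∈? T) then 0# else first x u (card (below v T)) * F (below (suc i) (v ∷ T))) ≈
      (if does (v ∈? T) then 0# else first x u (card (below v T)) * F (does (i ∈? T) ∷ below i (v ∷ T)))
    pointwise v v<i rewrite ≡ᵇ-false (ℕₚ.>⇒≢ v<i) = refl
    final : insertions x u (F ∘ (does (i ∈? T) ∷_)) (below i T) +
      (if does (i ∈? T) then 0# else first x u (card (below i T)) * F (below (suc i) (i ∷ T))) ≈
      insertions x u F (below (suc i) T)
    final rewrite ≡ᵇ-true {i} ≡.refl | below-cons-≥ {i} T ℕₚ.≤-refl with does (i ∈? T)
    ... | true  = +-identityʳ _
    ... | false = +-comm _ _

  Σ-odd : ∀ {M i T} → Tail M (suc i) T → evenᵇ i ≡ false →
    Σ< M (λ v → localWeight M i v T * completion i (below i (v ∷ T))) ≈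
    Σ< i (λ v → localWeight M i v T * completion i (below i (v ∷ T))) +
      localWeight M i i T * completion i (below i T)
  Σ-odd {M} {i} {T} t e = trans (Σ-truncate {suc i} _ (tail-start t) high)
    (trans (Σ-last i _) (+-congˡ (*-congˡ (reflexive (≡.cong (completion i) (below-cons-≥ {i} T ℕₚ.≤-refl))))))
    where
    high : ∀ v → i < v → localWeight M i v T * completion i (below i (v ∷ T)) ≈ 0#
    high v i<v with toSum (v ∈? T)
    ... | inj₁ v∈T = trans (*-congʳ (reflexive (local-∈ M i v∈T))) (zeroˡ _)
    ... | inj₂ v∉T = trans (*-congʳ (local-high M i<v v∉T e)) (zeroˡ _)

  Σ-deficiency : ∀ {M i T} x u → evenᵇ i ≡ false →
    (∀ v → deficiencyWeight i v T ≡ first x u (card (below v T))) →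
    Σ< i (λ v → localWeight M i v T * completion i (below i (v ∷ T))) ≈
    insertions x u (completion i) (below i T)
  Σ-deficiency {M} {i} {T} x u e d = trans (Σ-cong< i pointwise) (Σ-insertions x u i T (completion i))
    where
    pointwise : ∀ v → v < i → localWeight M i v T * completion i (below i (v ∷ T)) ≈
      (if does (v ∈? T) then 0# else first x u (card (below v T)) * completion i (below i (v ∷ T)))
    pointwise v v<i = go (v ∈? T) ≡.refl
      where
      go : (d? : Dec (v ∈ T)) → does (v ∈? T) ≡ does d? → localWeight M i v T * completion i (below i (v ∷ T)) ≈
        (if does (v ∈? T) then 0# else first x u (card (below v T)) * completion i (below i (v ∷ T)))
      go (yes v∈T) q rewrite q = zeroˡ _
      go (no v∉T) q = trans (*-congʳ (trans (local-deficiency M v<i v∉T e) (reflexive (d v))))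
        (reflexive (≡.sym (if-cong q)))

  Σ-local-even : ∀ {M i T} → Tail M (suc i) T → evenᵇ i ≡ true →
    Σ< M (λ v → localWeight M i v T * completion i (below i (v ∷ T))) ≈
    (if does (i ∈? T) then valley (card (below i T)) else oddLevel (card (below i T))) * completion i (below i T)
  Σ-local-even {M} {i} {T} t e = begin
    Σ< M (λ v → localWeight M i v T * completion i (below i (v ∷ T)))
      ≈⟨ Σ-cong M pointwise ⟩
    Σ< M (λ v → localWeight M i v T * completion i (below i T))
      ≈⟨ Σ-*ʳ M (completion i (below i T)) (λ v → localWeight M i v T) ⟩
    Σ< M (λ v → localWeight M i v T) * completion i (below i T)
      ≈⟨ *-congʳ (total (i ∈? T) ≡.refl) ⟩
    (if does (i ∈? T) then valley (card (below i T)) else oddLevel (card (below i T))) * completion i (below i T) ∎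
    where
    total : (d? : Dec (i ∈ T)) → does (i ∈? T) ≡ does d? → Σ< M (λ v → localWeight M i v T) ≈
      (if does (i ∈? T) then valley (card (below i T)) else oddLevel (card (below i T)))
    total (yes i∈T) q = trans (Σ-valley t i∈T e) (reflexive (≡.sym (if-cong q)))
    total (no i∉T) q = trans (Σ-oddLevel t i∉T e) (reflexive (≡.sym (if-cong q)))
    pointwise : ∀ v → localWeight M i v T * completion i (below i (v ∷ T)) ≈
                      localWeight M i v T * completion i (below i T)
    pointwise v with v <? i
    ... | no v≮i = *-congˡ (reflexive (≡.cong (completion i) (below-cons-≥ {i} T (ℕₚ.≮⇒≥ v≮i))))
    ... | yes v<i with toSum (v ∈? T)
    ...   | inj₁ v∈T = trans (*-congʳ (reflexive (local-∈ M i v∈T))) (trans (trans (zeroˡ _) (sym (zeroˡ _)))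
                        (*-congʳ (reflexive (≡.sym (local-∈ M i v∈T)))))
    ...   | inj₂ v∉T = trans (*-congʳ (local-low M v<i v∉T e)) (trans (trans (zeroˡ _) (sym (zeroˡ _)))
                        (*-congʳ (sym (local-low M v<i v∉T e))))

  Σ-local-odd : ∀ {M i T} → Tail M (suc i) T → evenᵇ i ≡ false →
    Σ< M (λ v → localWeight M i v T * completion i (below i (v ∷ T))) ≈
    (if does (i ∈? T) then insertions x₂ u₂ (completion i) (below i T)
      else λ' * first zₑ wₑ (card (below i T)) * completion i (below i T) +
           insertions x₁ u₁ (completion i) (below i T))
  Σ-local-odd {M} {i} {T} t e = trans (Σ-odd t e) (split (i ∈? T) ≡.refl)
    where
    split : (d? : Dec (i ∈ T)) → does (i ∈? T) ≡ does d? →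
      Σ< i (λ v → localWeight M i v T * completion i (below i (v ∷ T))) +
        localWeight M i i T * completion i (below i T) ≈
      (if does (i ∈? T) then insertions x₂ u₂ (completion i) (below i T)
        else λ' * first zₑ wₑ (card (below i T)) * completion i (below i T) +
             insertions x₁ u₁ (completion i) (below i T))
    split (yes i∈T) q = trans (+-cong
        (Σ-deficiency {M} {i} {T} x₂ u₂ e (λ v → if-cong q))
        (trans (*-congʳ (reflexive (local-∈ M i i∈T))) (zeroˡ _)))
      (trans (+-identityʳ _) (reflexive (≡.sym (if-cong q))))
    split (no i∉T) q = trans (+-cong
        (Σ-deficiency {M} {i} {T} x₁ u₁ e (λ v → if-cong q))
        (*-congʳ (trans (local-fixed M i i∉T) (*-congˡ (reflexive (if-cong e))))))
      (trans (+-comm _ _) (reflexive (≡.sym (if-cong q))))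

  -- Justifies the recursion of `completion`: the weights of position i depend on the order of T and
  -- on its paths, their sum only on `below (suc i) T`.
  Σ-local : ∀ {M i T} → Tail M (suc i) T →
    Σ< M (λ v → localWeight M i v T * completion i (below i (v ∷ T))) ≈ completion (suc i) (below (suc i) T)
  Σ-local {M} {i} {T} t = go (evenᵇ i) ≡.refl
    where
    go : ∀ b → evenᵇ i ≡ b →
      Σ< M (λ v → localWeight M i v T * completion i (below i (v ∷ T))) ≈ completion (suc i) (below (suc i) T)
    go true  e = trans (Σ-local-even t e) (reflexive (≡.sym (if-cong e)))
    go false e = trans (Σ-local-odd t e) (reflexive (≡.sym (if-cong e)))

  -- `Σ-local` requires distinct images. A vector with a repetition has an explicit zero factor, so
  -- its inner sum does not matter.
  tail-or-zero : ∀ {M k} i → i ℕ.+ k ≡ M → (T : Vec (Fin M) k) →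
                 Tail M i (vals T) ⊎ tailWeight M i (vals T) ≈ 0#
  tail-or-zero {M} i e [] = inj₁ (≡.subst (λ j → Tail M j []) (≡.trans (≡.sym e) (ℕₚ.+-identityʳ i)) [])
  tail-or-zero {M} {suc k} i e (v ∷ T) with tail-or-zero (suc i) (≡.trans (≡.sym (ℕₚ.+-suc i k)) e) T | toSum (toℕ v ∈? vals T)
  ... | inj₂ z | _        = inj₂ (trans (*-congˡ z) (zeroʳ _))
  ... | inj₁ t | inj₁ v∈T = inj₂ (trans (*-congʳ (reflexive (local-∈ M i v∈T))) (zeroˡ _))
  ... | inj₁ t | inj₂ v∉T  = inj₁ ((toℕ<n v , v∉T) ∷ t)

  -- With i + k = M this interpolates between the full sum over vectors (k = M) and `completion` at
  -- the empty set (k = 0); it is constant along the way.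
  total : ∀ M k i → Carrier
  total M k i = sumL (map (λ T → tailWeight M i (vals T) * completion i (below i (vals T))) (vecs M k))

  total-step : ∀ {M} k i → i ℕ.+ suc k ≡ M → total M (suc k) i ≈ total M k (suc i)
  total-step {M} k i e = trans (sumL-vecs-suc {M} {k} (λ T → tailWeight M i (vals T) * completion i (below i (vals T))))
    (sumL-cong (vecs M k) step)
    where
    step : ∀ T → sumL (map (λ v → localWeight M i (toℕ v) (vals T) * tailWeight M (suc i) (vals T) *
                                  completion i (below i (toℕ v ∷ vals T))) (allFin M)) ≈
                 tailWeight M (suc i) (vals T) * completion (suc i) (below (suc i) (vals T))
    step T = begin
      _ ≡⟨ sumL-allFin M (λ v → localWeight M i v (vals T) * W * completion i (below i (v ∷ vals T))) ⟩
      Σ< M (λ v → localWeight M i v (vals T) * W * completion i (below i (v ∷ vals T)))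
        ≈⟨ Σ-cong M (λ v → trans (*-congʳ (*-comm _ W)) (*-assoc W _ _)) ⟩
      Σ< M (λ v → W * (localWeight M i v (vals T) * completion i (below i (v ∷ vals T))))
        ≈⟨ Σ-*ˡ M W _ ⟩
      W * Σ< M (λ v → localWeight M i v (vals T) * completion i (below i (v ∷ vals T)))
        ≈⟨ collapse (tail-or-zero (suc i) (≡.trans (≡.sym (ℕₚ.+-suc i k)) e) T) ⟩
      W * completion (suc i) (below (suc i) (vals T)) ∎
      where
      W : Carrier
      W = tailWeight M (suc i) (vals T)
      collapse : Tail M (suc i) (vals T) ⊎ W ≈ 0# →
        W * Σ< M (λ v → localWeight M i v (vals T) * completion i (below i (v ∷ vals T))) ≈
        W * completion (suc i) (below (suc i) (vals T))
      collapse (inj₁ t) = *-congˡ (Σ-local t)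
      collapse (inj₂ z) = trans (*-congʳ z) (trans (trans (zeroˡ _) (sym (zeroˡ _))) (*-congʳ (sym z)))

  total-collapse : ∀ {M} k i → i ℕ.+ k ≡ M → total M k i ≈ completion M (emptySubset M)
  total-collapse {M} zero i e rewrite ≡.trans (≡.sym (ℕₚ.+-identityʳ i)) e | below-[] M =
    trans (+-identityʳ _) (*-identityˡ _)
  total-collapse (suc k) i e = trans (total-step k i e) (total-collapse k (suc i) (≡.trans (≡.sym (ℕₚ.+-suc i k)) e))

  sum-tailWeight : ∀ M → sumL (map (λ T → tailWeight M 0 (vals T)) (vecs M M)) ≈ completion M (emptySubset M)
  sum-tailWeight M = trans (sumL-cong (vecs M M) (λ T → sym (*-identityʳ _))) (total-collapse M 0 ≡.refl)

-- Reflection of Boolean tests into propositions.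

≡ᵇ-true⁻ : ∀ {m n} → (m ≡ᵇ n) ≡ true → m ≡ n
≡ᵇ-true⁻ {m} {n} e with m ≟ n
... | yes p = p
... | no p with () ← ≡.trans (≡.sym e) (≡ᵇ-false p)

<ᵇ-true⁻ : ∀ {m n} → (m <ᵇ n) ≡ true → m < n
<ᵇ-true⁻ {m} {n} e with m <? n
... | yes p = p
... | no p with () ← ≡.trans (≡.sym e) (<ᵇ-false (ℕₚ.≮⇒≥ p))

≤ᵇ-true : ∀ {m n} → m ≤ n → (m ≤ᵇ n) ≡ true
≤ᵇ-true {m} {n} = dec-true (m ≤? n)

≤ᵇ-true⁻ : ∀ {m n} → (m ≤ᵇ n) ≡ true → m ≤ n
≤ᵇ-true⁻ {m} {n} e with m ≤? n
... | yes p = p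
... | no p with () ← ≡.trans (≡.sym e) (dec-false (m ≤? n) p)

∧-true⁻ : ∀ {a b} → a ∧ b ≡ true → a ≡ true × b ≡ true
∧-true⁻ {true} {true} _ = ≡.refl , ≡.refl

Bool-ext : ∀ {a b} → (a ≡ true → b ≡ true) → (b ≡ true → a ≡ true) → a ≡ b
Bool-ext {true}  {b}     f g = ≡.sym (f ≡.refl)
Bool-ext {false} {true}  f g = g ≡.refl
Bool-ext {false} {false} f g = ≡.refl

true-or-false : ∀ b → b ≡ true ⊎ b ≡ false
true-or-false true  = inj₁ ≡.refl
true-or-false false = inj₂ ≡.refl

⇒ᵇ-true : ∀ {a b} → (a ≡ true → b ≡ true) → not a ∨ b ≡ true
⇒ᵇ-true {true}  f = f ≡.refl
⇒ᵇ-true {false} f = ≡.refl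

⇒ᵇ-true⁻ : ∀ {a b} → not a ∨ b ≡ true → a ≡ true → b ≡ true
⇒ᵇ-true⁻ e ≡.refl = e

all-true : ∀ {A : Set} (p : A → Bool) xs → (∀ {x} → x ∈ xs → p x ≡ true) → all p xs ≡ true
all-true p []       h = ≡.refl
all-true p (x ∷ xs) h rewrite h (here ≡.refl) = all-true p xs (h ∘ there)

all-true⁻ : ∀ {A : Set} (p : A → Bool) {xs x} → all p xs ≡ true → x ∈ xs → p x ≡ true
all-true⁻ p e (here ≡.refl) = proj₁ (∧-true⁻ e)
all-true⁻ p {y ∷ _} e (there x∈) = all-true⁻ p (proj₂ (∧-true⁻ {p y} e)) x∈

any-true : ∀ {A : Set} (p : A → Bool) {xs x} → x ∈ xs → p x ≡ true → any p xs ≡ true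
any-true p (here ≡.refl) e rewrite e = ≡.refl
any-true p {y ∷ _} (there x∈) e with p y
... | true  = ≡.refl
... | false = any-true p x∈ e

any-true⁻ : ∀ {A : Set} (p : A → Bool) xs → any p xs ≡ true → ∃ λ x → p x ≡ true
any-true⁻ p (x ∷ xs) e with p x in px
... | true  = x , px
... | false = any-true⁻ p xs e

allBelow-true⁻ : ∀ n p {i} → allBelow n p ≡ true → i < n → p i ≡ true
allBelow-true⁻ n p {i} e i<n with true-or-false (p i)
... | inj₁ t = t
... | inj₂ f with () ← ≡.trans (≡.sym e) (allBelow-false n p i<n f)

card-below-none : ∀ i T → (∀ {x} → x ∈ T → i ≤ x) → card (below i T) ≡ 0
card-below-none zero    T h = ≡.refl
card-below-none (suc i) T h rewrite dec-false (i ∈? T) (λ i∈T → ℕₚ.<-irrefl ≡.refl (h i∈T)) =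
  card-below-none i T (λ x∈T → ℕₚ.<⇒≤ (h x∈T))

-- Records, preimages and cycles of σ, read off its tails.

module Positions {M : ℕ} (σ : Vec (Fin M) M) where
  open Perm σ

  -- Ties a list to σ without asking for distinct values, so that it also covers the vectors that
  -- are not permutations.
  data Aligned : ℕ → List ℕ → Set where
    []  : Aligned M []
    _∷_ : ∀ p {T} → Aligned (suc (toℕ p)) T → Aligned (toℕ p) (ap p ∷ T)

  aligned-∈⁻ : ∀ {i T x} → Aligned i T → x ∈ T → ∃ λ p → i ≤ toℕ p × ap p ≡ x
  aligned-∈⁻ (p ∷ a) (here e) = p , ℕₚ.≤-refl , ≡.sym e
  aligned-∈⁻ (p ∷ a) (there x∈T) with aligned-∈⁻ a x∈T
  ... | q , p<q , e = q , ℕₚ.<⇒≤ p<q , e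

  aligned-∈ : ∀ {i T} → Aligned i T → ∀ {p} → i ≤ toℕ p → ap p ∈ T
  aligned-∈ []      {p} M≤p = contradiction (toℕ<n p) (ℕₚ.≤⇒≯ M≤p)
  aligned-∈ (q ∷ a) {p} q≤p with toℕ q ≟ toℕ p
  ... | yes e = here (≡.cong ap (≡.sym (toℕ-injective e)))
  ... | no q≢p = there (aligned-∈ a (ℕₚ.≤∧≢⇒< q≤p q≢p))

  -- `ι` is the embedding of the index j as position i + j; carried as a function, it spares casts
  -- between index types.
  aligned-vals : ∀ {k} i (T : Vec (Fin M) k) → i ℕ.+ k ≡ M → (ι : Fin k → Fin M) →
    (∀ j → toℕ (ι j) ≡ i ℕ.+ toℕ j) → (∀ j → lookup σ (ι j) ≡ lookup T j) → Aligned i (vals T)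
  aligned-vals i [] e ι ιp ιv = ≡.subst (λ j → Aligned j []) (≡.trans (≡.sym e) (ℕₚ.+-identityʳ i)) []
  aligned-vals i (v ∷ T) e ι ιp ιv =
    ≡.subst (λ j → Aligned j (toℕ v ∷ vals T)) p≡i
      (≡.subst (λ w → Aligned (toℕ (ι zero)) (toℕ w ∷ vals T)) (ιv zero)
        (ι zero ∷ ≡.subst (λ j → Aligned (suc j) (vals T)) (≡.sym p≡i)
          (aligned-vals (suc i) T (≡.trans (≡.sym (ℕₚ.+-suc i _)) e) (ι ∘ suc)
            (λ j → ≡.trans (ιp (suc j)) (ℕₚ.+-suc i (toℕ j))) (ιv ∘ suc))))
    where
    p≡i : toℕ (ι zero) ≡ i
    p≡i = ≡.trans (ιp zero) (ℕₚ.+-identityʳ i)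

  aligned : Aligned 0 (vals σ)
  aligned = aligned-vals 0 σ ≡.refl id (λ _ → ≡.refl) (λ _ → ≡.refl)

  Injective : Set
  Injective = ∀ {p q} → ap p ≡ ap q → p ≡ q

  Alternating : Fin M → Set
  Alternating p = (evenᵇ (toℕ p) ≡ true → toℕ p ≤ ap p) × (evenᵇ (toℕ p) ≡ false → ap p ≤ toℕ p)

  isPerm⇒ : isPerm ≡ true → Injective
  isPerm⇒ e {p} {q} apq = toℕ-injective (≡ᵇ-true⁻ (⇒ᵇ-true⁻
    (all-true⁻ (λ j → not (ap p ≡ᵇ ap j) ∨ (pos p ≡ᵇ pos j))
      (all-true⁻ (λ i → all (λ j → not (ap i ≡ᵇ ap j) ∨ (pos i ≡ᵇ pos j)) fins) e (∈-allFin p)) (∈-allFin q))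
    (≡ᵇ-true apq)))

  ⇒isPerm : Injective → isPerm ≡ true
  ⇒isPerm inj = all-true _ fins (λ {p} _ → all-true _ fins (λ {q} _ →
    ⇒ᵇ-true (λ e → ≡ᵇ-true (≡.cong toℕ (inj {p} {q} (≡ᵇ-true⁻ e))))))

  isD⇒ : isD ≡ true → ∀ p → Alternating p
  isD⇒ e p with evenᵇ (toℕ p) | all-true⁻ (λ i → if evenᵇ (pos i) then pos i ≤ᵇ ap i else ap i ≤ᵇ pos i) e (∈-allFin p)
  ... | true  | h = (λ _ → ≤ᵇ-true⁻ h) , (λ ())
  ... | false | h = (λ ()) , (λ _ → ≤ᵇ-true⁻ h)

  ⇒isD : (∀ p → Alternating p) → isD ≡ true
  ⇒isD alt = all-true _ fins (λ {p} _ → at p)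
    where
    at : ∀ p → (if evenᵇ (pos p) then pos p ≤ᵇ ap p else ap p ≤ᵇ pos p) ≡ true
    at p with evenᵇ (toℕ p) | alt p
    ... | true  | h , _ = ≤ᵇ-true (h ≡.refl)
    ... | false | _ , h = ≤ᵇ-true (h ≡.refl)

  tail⇒injective : ∀ {i T} → Aligned i T → Tail M i T → ∀ {p q} → i ≤ toℕ p → i ≤ toℕ q → ap p ≡ ap q → p ≡ q
  tail⇒injective []      t {p} M≤p _ _ = contradiction (toℕ<n p) (ℕₚ.≤⇒≯ M≤p)
  tail⇒injective (r ∷ a) ((_ , r∉T) ∷ t) {p} {q} r≤p r≤q e with toℕ r ≟ toℕ p | toℕ r ≟ toℕ q
  ... | yes x | yes y = toℕ-injective (≡.trans (≡.sym x) y)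
  ... | no x | no y = tail⇒injective a t (ℕₚ.≤∧≢⇒< r≤p x) (ℕₚ.≤∧≢⇒< r≤q y) e
  ... | yes x | no y with ≡.refl ← toℕ-injective {i = r} {p} x =
    contradiction (≡.subst (_∈ _) (≡.sym e) (aligned-∈ a (ℕₚ.≤∧≢⇒< r≤q y))) r∉T
  ... | no x | yes y with ≡.refl ← toℕ-injective {i = r} {q} y =
    contradiction (≡.subst (_∈ _) e (aligned-∈ a (ℕₚ.≤∧≢⇒< r≤p x))) r∉T

  injective⇒∉ : Injective → ∀ {i T p} → Aligned i T → toℕ p < i → ap p ∉ T
  injective⇒∉ inj a p<i p∈T with aligned-∈⁻ a p∈T
  ... | q , i≤q , e with ≡.refl ← inj e = ℕₚ.<⇒≱ p<i i≤q

  injective⇒tail : Injective → ∀ {i T} → Aligned i T → Tail M i T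
  injective⇒tail inj []      = []
  injective⇒tail inj (p ∷ a) = (toℕ<n (lookup σ p) , injective⇒∉ inj a ℕₚ.≤-refl) ∷ injective⇒tail inj a

  iter-+ : ∀ m n p → iter (m ℕ.+ n) p ≡ iter m (iter n p)
  iter-+ zero    n p = ≡.refl
  iter-+ (suc m) n p = ≡.cong (lookup σ) (iter-+ m n p)

  iter-suc : ∀ n p → iter (suc n) p ≡ iter n (lookup σ p)
  iter-suc n p = ≡.trans (≡.cong (λ m → iter m p) (ℕₚ.+-comm 1 n)) (iter-+ n 1 p)

  -- The path behind `endpoint` is a piece of a σ-orbit. The bound on the positions visited before
  -- the end is what makes i least on a path that closes at i.
  endpoint-iter : ∀ {i T} → Aligned i T → ∀ u →
    ∃ λ k → toℕ (iter k u) ≡ endpoint i T (toℕ u) × (∀ j → j < k → i ≤ toℕ (iter j u))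
  endpoint-iter []      u = 0 , ≡.refl , λ _ ()
  endpoint-iter (_∷_ p {T} a) u with endpoint-iter a u | endpoint (suc (toℕ p)) T (toℕ u) ≟ toℕ p
  ... | k , ek , hk | no e = k , ≡.trans ek (≡.sym (endpoint-avoid (ap p) T (toℕ u) e)) , λ j j<k → ℕₚ.<⇒≤ (hk j j<k)
  ... | k , ek , hk | yes e with endpoint-iter a (lookup σ p)
  ...   | l , el , hl = l ℕ.+ suc k , ≡.trans (≡.cong toℕ (later l)) (≡.trans el (≡.sym (endpoint-through (ap p) T (toℕ u) e))) , bound
    where
    reached : iter k u ≡ p
    reached = toℕ-injective (≡.trans ek e)
    later : ∀ j → iter (j ℕ.+ suc k) u ≡ iter j (lookup σ p)
    later j = ≡.trans (iter-+ j (suc k) u) (≡.cong (iter j ∘ lookup σ) reached)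
    bound : ∀ j → j < l ℕ.+ suc k → toℕ p ≤ toℕ (iter j u)
    bound j j< with ℕₚ.<-cmp j k
    ... | tri< j<k _ _ = ℕₚ.<⇒≤ (hk j j<k)
    ... | tri≈ _ ≡.refl _ = ℕₚ.≤-reflexive (≡.cong toℕ (≡.sym reached))
    ... | tri> _ _ k<j = ≡.subst (λ m → toℕ p ≤ toℕ (iter m u)) (ℕₚ.m∸n+n≡m k<j)
          (≡.subst (λ q → toℕ p ≤ toℕ q) (≡.sym (later (j ℕ.∸ suc k)))
            (ℕₚ.<⇒≤ (hl (j ℕ.∸ suc k) (ℕₚ.+-cancelʳ-< (suc k) _ _ (≡.subst (_< l ℕ.+ suc k) (≡.sym (ℕₚ.m∸n+n≡m k<j)) j<)))))

  iter-periodic : ∀ {d p} → iter (suc d) p ≡ p → ∀ n → ∃ λ r → r ≤ d × iter n p ≡ iter r p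
  iter-periodic e zero    = 0 , z≤n , ≡.refl
  iter-periodic {d} e (suc n) with iter-periodic e n
  ... | r , r≤d , er with r ≟ d
  ...   | yes ≡.refl = 0 , z≤n , ≡.trans (≡.cong (lookup σ) er) e
  ...   | no r≢d = suc r , ℕₚ.≤∧≢⇒< r≤d r≢d , ≡.cong (lookup σ) er

  module _ (inj : Injective) where

    iter-injective : ∀ n {p q} → iter n p ≡ iter n q → p ≡ q
    iter-injective zero    e = e
    iter-injective (suc n) e = iter-injective n (inj (≡.cong toℕ e))

    -- Two of the first M + 1 iterates agree, and injectivity strips their common part. The bound is
    -- needed because `cycMin` tests only M iterates.
    iter-returns : ∀ p → ∃ λ d → suc d ≤ M × iter (suc d) p ≡ p
    iter-returns p with pigeonhole {n = suc M} ℕₚ.≤-refl (λ k → iter (toℕ k) p)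
    ... | a , b , a<b , e = d , bound , ≡.sym (iter-injective (toℕ a) (≡.trans e (≡.trans (≡.cong (λ m → iter m p) b≡) (iter-+ (toℕ a) (suc d) p))))
      where
      d : ℕ
      d = toℕ b ℕ.∸ suc (toℕ a)
      b≡ : toℕ b ≡ toℕ a ℕ.+ suc d
      b≡ = ≡.trans (≡.sym (ℕₚ.m+[n∸m]≡n a<b)) (≡.sym (ℕₚ.+-suc (toℕ a) d))
      bound : suc d ≤ M
      bound = ℕₚ.≤-trans (ℕₚ.m≤n+m (suc d) (toℕ a)) (≡.subst (_≤ M) b≡ (ℕₚ.≤-pred (toℕ<n b)))

    -- A value missing from all of σ would start a path ending at a position below 0.
    surjective : ∀ {u} → u < M → ∃ λ p → ap p ≡ u
    surjective {u} u<M with toSum (u ∈? vals σ)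
    ... | inj₁ u∈ with aligned-∈⁻ aligned u∈
    ...   | p , _ , e = p , e
    surjective {u} u<M | inj₂ u∉ with () ← endpoint-< (injective⇒tail inj aligned) u<M u∉

    module _ {i : Fin M} {T : List ℕ} (a : Aligned (suc (toℕ i)) T) where
      private
        I v : ℕ
        I = toℕ i
        v = ap i
        t : Tail M (suc I) T
        t = injective⇒tail inj a
        v∉T : v ∉ T
        v∉T = injective⇒∉ inj a ℕₚ.≤-refl
        v<M : v < M
        v<M = toℕ<n (lookup σ i)

      ∉⇒earlier : ∀ {u} → u < M → u ∉ T → ∃ λ j → toℕ j ≤ I × ap j ≡ u
      ∉⇒earlier u<M u∉T with surjective u<M
      ... | j , e = j , ℕₚ.≮⇒≥ (λ i<j → u∉T (≡.subst (_∈ T) e (aligned-∈ a i<j))) , e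

      arec⇒ : arec i ≡ true → ∀ {x} → x ∈ T → v < x
      arec⇒ e x∈T with aligned-∈⁻ a x∈T
      ... | j , i<j , ≡.refl = <ᵇ-true⁻ (⇒ᵇ-true⁻
        (all-true⁻ (λ j → not (pos i <ᵇ pos j) ∨ (ap i <ᵇ ap j)) e (∈-allFin j)) (<ᵇ-true i<j))

      ⇒arec : (∀ {x} → x ∈ T → v < x) → arec i ≡ true
      ⇒arec h = all-true _ fins (λ _ → ⇒ᵇ-true (λ e → <ᵇ-true (h (aligned-∈ a (<ᵇ-true⁻ e)))))

      arec-card : arec i ≡ (card (below v T) ≡ᵇ 0)
      arec-card = Bool-ext
        (λ e → ≡ᵇ-true (card-below-none v T (λ x∈T → ℕₚ.<⇒≤ (arec⇒ e x∈T))))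
        (λ e → ⇒arec (λ x∈T → ℕₚ.≤∧≢⇒< (ℕₚ.≮⇒≥ (λ x<v → card-below-zero v T (≡ᵇ-true⁻ e) x<v x∈T))
                                        (λ { ≡.refl → v∉T x∈T })))

      maximal⇒ : maximalMissing M T v ≡ true → ∀ {u} → u < M → u ∉ T → u ≤ v
      maximal⇒ e {u} u<M u∉T = ℕₚ.≮⇒≥ λ v<u → contradiction
        (≡.trans (≡.sym (⇒ᵇ-true⁻ (allBelow-true⁻ M (λ u → not (v <ᵇ u) ∨ does (u ∈? T)) e u<M) (<ᵇ-true v<u)))
                 (dec-false (u ∈? T) u∉T))
        (λ ())

      ⇒maximal : (∀ {u} → v < u → u < M → u ∈ T) → maximalMissing M T v ≡ true
      ⇒maximal h = allBelow-true M _ (λ u u<M → ⇒ᵇ-true (λ e → dec-true (u ∈? T) (h (<ᵇ-true⁻ e) u<M)))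

      rec-maximal : rec i ≡ maximalMissing M T v
      rec-maximal = Bool-ext
        (λ e → ⇒maximal (to e))
        (λ e → all-true _ fins (λ {j} _ → ⇒ᵇ-true (λ j<i → <ᵇ-true (from e (<ᵇ-true⁻ j<i)))))
        where
        to : rec i ≡ true → ∀ {u} → v < u → u < M → u ∈ T
        to e {u} v<u u<M with toSum (u ∈? T)
        ... | inj₁ u∈T = u∈T
        ... | inj₂ u∉T with ∉⇒earlier u<M u∉T
        ...   | j , j≤i , ≡.refl with toℕ j ≟ I
        ...     | yes j≡i with ≡.refl ← toℕ-injective {i = j} {i} j≡i = contradiction v<u (ℕₚ.<-irrefl ≡.refl)
        ...     | no j≢i = contradiction v<u (ℕₚ.<-asym (<ᵇ-true⁻ (⇒ᵇ-true⁻
                    (all-true⁻ (λ j → not (pos j <ᵇ pos i) ∨ (ap j <ᵇ ap i)) e (∈-allFin j))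
                    (<ᵇ-true (ℕₚ.≤∧≢⇒< j≤i j≢i)))))
        from : maximalMissing M T v ≡ true → ∀ {j} → toℕ j < I → ap j < v
        from e {j} j<i = ℕₚ.≤∧≢⇒< (maximal⇒ e (toℕ<n (lookup σ j)) (injective⇒∉ inj a (ℕₚ.m<n⇒m<1+n j<i)))
          (λ x → ℕₚ.<-irrefl (≡.cong toℕ (inj x)) j<i)

      preimage-after : pre i (λ p → pos i <ᵇ p) ≡ does (I ∈? T)
      preimage-after = Bool-ext to from
        where
        to : pre i (λ p → pos i <ᵇ p) ≡ true → does (I ∈? T) ≡ true
        to e with any-true⁻ (λ j → (ap j ≡ᵇ pos i) ∧ (pos i <ᵇ pos j)) fins e
        ... | j , h with ∧-true⁻ h
        ...   | x , y = dec-true (I ∈? T) (≡.subst (_∈ T) (≡ᵇ-true⁻ x) (aligned-∈ a (<ᵇ-true⁻ y)))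
        from : does (I ∈? T) ≡ true → pre i (λ p → pos i <ᵇ p) ≡ true
        from e with toSum (I ∈? T)
        ... | inj₂ I∉T with () ← ≡.trans (≡.sym e) (dec-false (I ∈? T) I∉T)
        ... | inj₁ I∈T with aligned-∈⁻ a I∈T
        ...   | j , i<j , x = any-true (λ j → (ap j ≡ᵇ pos i) ∧ (pos i <ᵇ pos j)) (∈-allFin j) (≡.cong₂ _∧_ (≡ᵇ-true x) (<ᵇ-true i<j))

      preimage-before : v ≢ I → pre i (λ p → p <ᵇ pos i) ≡ not (does (I ∈? T))
      preimage-before v≢I = Bool-ext to from
        where
        to : pre i (λ p → p <ᵇ pos i) ≡ true → not (does (I ∈? T)) ≡ true
        to e with any-true⁻ (λ j → (ap j ≡ᵇ pos i) ∧ (pos j <ᵇ pos i)) fins e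
        ... | j , h with ∧-true⁻ h
        ...   | x , y = ≡.cong not (dec-false (I ∈? T)
                (≡.subst (_∉ T) (≡ᵇ-true⁻ x) (injective⇒∉ inj a (ℕₚ.m<n⇒m<1+n (<ᵇ-true⁻ y)))))
        from : not (does (I ∈? T)) ≡ true → pre i (λ p → p <ᵇ pos i) ≡ true
        from e with toSum (I ∈? T)
        ... | inj₁ I∈T with () ← ≡.trans (≡.sym e) (≡.cong not (dec-true (I ∈? T) I∈T))
        ... | inj₂ I∉T with ∉⇒earlier (toℕ<n i) I∉T
        ...   | j , j≤i , x = any-true (λ j → (ap j ≡ᵇ pos i) ∧ (pos j <ᵇ pos i)) (∈-allFin j)
                (≡.cong₂ _∧_ (≡ᵇ-true x) (<ᵇ-true (ℕₚ.≤∧≢⇒< j≤i (λ j≡i → v≢I (≡.trans (≡.cong ap (≡.sym (toℕ-injective j≡i))) x)))))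

      -- Otherwise all later values exceed v, so none of them is at most i; then every value above i
      -- is taken later, v included.
      excedance⇒¬arec : I < v → arec i ≡ false
      excedance⇒¬arec I<v with true-or-false (arec i)
      ... | inj₂ e = e
      ... | inj₁ e = contradiction (none-open t (card-below-none (suc I) T
              (λ x∈T → ℕₚ.≤-trans I<v (ℕₚ.<⇒≤ (arec⇒ e x∈T)))) I<v v<M) v∉T

      -- Otherwise every missing value is at most v < i and is its own end, so no path ends at i.
      deficiency⇒¬rec : v < I → rec i ≡ false
      deficiency⇒¬rec v<I with true-or-false (rec i)
      ... | inj₂ e = e
      ... | inj₁ e with endpoint-surjective t ℕₚ.≤-refl
      ...   | u , u<M , u∉T , eu = contradiction
              (≡.trans (≡.sym (endpoint-low (suc I) T (ℕₚ.m<n⇒m<1+n u<I))) eu) (ℕₚ.<⇒≢ u<I)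
        where
        u<I : u < I
        u<I = ℕₚ.≤-<-trans (maximal⇒ (≡.trans (≡.sym rec-maximal) e) u<M u∉T) v<I

      -- Some value above i is missing exactly when some value below i is taken. As i is not in T,
      -- the thresholds i and i + 1 count the same taken values.
      fixed⇒rec-card : v ≡ I → rec i ≡ (card (below I T) ≡ᵇ 0)
      fixed⇒rec-card v≡I = ≡.trans rec-maximal (Bool-ext to from)
        where
        same : card (below (suc I) T) ≡ card (below I T)
        same rewrite dec-false (I ∈? T) (≡.subst (_∉ T) v≡I v∉T) = ≡.refl
        to : maximalMissing M T v ≡ true → (card (below I T) ≡ᵇ 0) ≡ true
        to e with card (below I T) in c
        ... | zero = ≡.refl
        ... | suc h with open-exists t (≡.trans same c)
        ...   | u , u<M , o with isOpen⇒ (suc I) T o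
        ...     | I<u , u∉T = contradiction (≡.subst (u ≤_) v≡I (maximal⇒ e u<M u∉T)) (ℕₚ.<⇒≱ I<u)
        from : (card (below I T) ≡ᵇ 0) ≡ true → maximalMissing M T v ≡ true
        from e = ⇒maximal (λ {u} v<u u<M → none-open t (≡.trans same (≡ᵇ-true⁻ e)) (≡.subst (_< u) v≡I v<u) u<M)

      -- The path from σ(i) ends at an iterate that is at most i; if i is least in its cycle, this
      -- iterate is i. Conversely a path back to i meets only larger positions before.
      cycMin-endpoint : cycMin i ≡ (endpoint (suc I) T v ≡ᵇ I)
      cycMin-endpoint with endpoint-iter a (lookup σ i)
      ... | k , ek , hk = Bool-ext (λ e → ≡ᵇ-true (to e)) (λ e → from (≡ᵇ-true⁻ e))
        where
        to : cycMin i ≡ true → endpoint (suc I) T v ≡ I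
        -- The index `suc k` may exceed the range tested by `cycMin`; it is first reduced modulo a
        -- period.
        to e with iter-returns i
        ... | d , d<M , ed with iter-periodic ed (suc k)
        ...   | r , r≤d , er = ℕₚ.≤-antisym (ℕₚ.≤-pred (endpoint-< t v<M v∉T))
                (≡.subst (I ≤_) (≡.trans (≡.cong toℕ (≡.trans (≡.sym er) (iter-suc k i))) ek)
                  (≤ᵇ-true⁻ (all-true⁻ (λ k → pos i ≤ᵇ toℕ (iter k i)) e (∈-upTo⁺ (ℕₚ.≤-<-trans r≤d d<M)))))
        from : endpoint (suc I) T v ≡ I → cycMin i ≡ true
        from e = all-true _ (upTo M) (λ {n} _ → ≤ᵇ-true (bound n))
          where
          closed : iter (suc k) i ≡ i
          closed = ≡.trans (iter-suc k i) (toℕ-injective (≡.trans ek e))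
          bound : ∀ n → I ≤ toℕ (iter n i)
          bound n with iter-periodic closed n
          ... | zero  , _   , er = ℕₚ.≤-reflexive (≡.cong toℕ (≡.sym er))
          ... | suc r , r<k , er = ≡.subst (λ q → I ≤ toℕ q) (≡.sym (≡.trans er (iter-suc r i))) (ℕₚ.<⇒≤ (hk r r<k))

-- The weight of σ as a product of local weights.

module Products {c ℓ : Level} (R : CommutativeRing c ℓ) where
  open CommutativeRing R hiding (zero)
  open Series R using (pow)
  open CSG *-commutativeSemigroup using () renaming (interchange to *-interchange)

  prodL : List Carrier → Carrier
  prodL = foldr _*_ 1#

  prodL-cong : ∀ {A : Set} {f g : A → Carrier} xs → (∀ x → f x ≈ g x) → prodL (map f xs) ≈ prodL (map g xs)
  prodL-cong []       e = refl
  prodL-cong (x ∷ xs) e = *-cong (e x) (prodL-cong xs e)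

  prodL-* : ∀ {A : Set} {a b} (f g : A → Carrier) xs → a ≈ prodL (map f xs) → b ≈ prodL (map g xs) →
            a * b ≈ prodL (map (λ x → f x * g x) xs)
  prodL-* f g xs ea eb = trans (*-cong ea eb) (go xs)
    where
    go : ∀ xs → prodL (map f xs) * prodL (map g xs) ≈ prodL (map (λ x → f x * g x) xs)
    go []       = *-identityˡ 1#
    go (x ∷ xs) = trans (*-interchange _ _ _ _) (*-congˡ (go xs))

  pow-count : ∀ {A : Set} x (p : A → Bool) xs → pow x (countᵇ p xs) ≈ prodL (map (λ i → if p i then x else 1#) xs)
  pow-count x p []       = refl
  pow-count x p (i ∷ xs) with p i
  ... | true  = *-congˡ (pow-count x p xs)
  ... | false = trans (pow-count x p xs) (sym (*-identityˡ _))

module PermutationWeights {c ℓ : Level} (R : CommutativeRing c ℓ)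
    (x₁ x₂ y₁ y₂ u₁ u₂ v₂ wₑ wₒ zₑ zₒ λ' : CommutativeRing.Carrier R) where
  open CommutativeRing R hiding (zero)
  open Series R using (sumL; pow; weight)
  open SubsetSums R using (first)
  open ListSums R
  open Products R
  open LocalWeights R x₁ x₂ y₁ y₂ u₁ u₂ v₂ wₑ wₒ zₑ zₒ λ'
  open Solver commutativeSemiring using (solve; _:=_; _:*_; con; Polynomial)
  open SetoidReasoning setoid

  -- The thirteen factors of one index in terms of free Booleans, so that each kind of index becomes
  -- a finite check. The seventh factor is y₁ in place of v₁.
  factors : (rec arec before after less greater equal odd closing : Bool) → Carrier
  factors rec arec before after less greater equal odd closing =
      (if (arec ∧ not rec) ∧ (before ∧ less) then x₁ else 1#)
    * (if (arec ∧ not rec) ∧ (after ∧ less) then x₂ else 1#)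
    * (if (rec ∧ not arec) ∧ (after ∧ greater) then y₁ else 1#)
    * (if (rec ∧ not arec) ∧ (before ∧ greater) then y₂ else 1#)
    * (if (not rec ∧ not arec) ∧ (before ∧ less) then u₁ else 1#)
    * (if (not rec ∧ not arec) ∧ (after ∧ less) then u₂ else 1#)
    * (if (not rec ∧ not arec) ∧ (after ∧ greater) then y₁ else 1#)
    * (if (not rec ∧ not arec) ∧ (before ∧ greater) then v₂ else 1#)
    * (if not odd ∧ ((not rec ∧ not arec) ∧ equal) then wₑ else 1#)
    * (if odd ∧ ((not rec ∧ not arec) ∧ equal) then wₒ else 1#)
    * (if not odd ∧ (rec ∧ arec) then zₑ else 1#)
    * (if odd ∧ (rec ∧ arec) then zₒ else 1#)
    * (if closing then λ' else 1#)

  module _ {M : ℕ} (σ : Vec (Fin M) M) where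
    open Perm σ
    open Positions σ

    factorsAt : Fin M → Carrier
    factorsAt i = factors (rec i) (arec i) (pre i (λ p → p <ᵇ pos i)) (pre i (λ p → pos i <ᵇ p))
                          (ap i <ᵇ pos i) (pos i <ᵇ ap i) (fix i) (evenᵇ (pos i)) (cycMin i)

    weight-factors : weight x₁ x₂ y₁ y₂ u₁ u₂ y₁ v₂ wₑ wₒ zₑ zₒ λ' σ ≈ prodL (map factorsAt fins)
    weight-factors =
      (prodL-* _ _ fins (prodL-* _ _ fins (prodL-* _ _ fins (prodL-* _ _ fins
      (prodL-* _ _ fins (prodL-* _ _ fins (prodL-* _ _ fins (prodL-* _ _ fins
      (prodL-* _ _ fins (prodL-* _ _ fins (prodL-* _ _ fins (prodL-* _ _ fins
        (pow-count x₁ (λ i → earec i ∧ cpeak i) fins)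
        (pow-count x₂ (λ i → earec i ∧ cdfall i) fins))
        (pow-count y₁ (λ i → erec i ∧ cval i) fins))
        (pow-count y₂ (λ i → erec i ∧ cdrise i) fins))
        (pow-count u₁ (λ i → nr i ∧ cpeak i) fins))
        (pow-count u₂ (λ i → nr i ∧ cdfall i) fins))
        (pow-count y₁ (λ i → nr i ∧ cval i) fins))
        (pow-count v₂ (λ i → nr i ∧ cdrise i) fins))
        (pow-count wₑ (λ i → evenIdx i ∧ nr i ∧ fix i) fins))
        (pow-count wₒ (λ i → oddIdx i ∧ nr i ∧ fix i) fins))
        (pow-count zₑ (λ i → evenIdx i ∧ rar i) fins))
        (pow-count zₒ (λ i → oddIdx i ∧ rar i) fins))
        (pow-count λ' cycMin fins))

  closingFactor : Bool → Carrier
  closingFactor b = if b then λ' else 1#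

  module Monomials where
    product : ∀ {n} → (a b d e f g h i j k l m o : Polynomial n) → Polynomial n
    product a b d e f g h i j k l m o = a :* b :* d :* e :* f :* g :* h :* i :* j :* k :* l :* m :* o
    I : ∀ {n} → Polynomial n
    I = con 1
  open Monomials

  factors-peak : ∀ α odd cl → factors false α true false true false false odd cl ≈ closingFactor cl * (if α then x₁ else u₁)
  factors-peak true  true  cl = solve 2 (λ x q → product x I I I I I I I I I I I q := q :* x) refl x₁ (closingFactor cl)
  factors-peak true  false cl = solve 2 (λ x q → product x I I I I I I I I I I I q := q :* x) refl x₁ (closingFactor cl)
  factors-peak false true  cl = solve 2 (λ x q → product I I I I x I I I I I I I q := q :* x) refl u₁ (closingFactor cl)
  factors-peak false false cl = solve 2 (λ x q → product I I I I x I I I I I I I q := q :* x) refl u₁ (closingFactor cl)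

  factors-fall : ∀ α odd cl → factors false α false true true false false odd cl ≈ closingFactor cl * (if α then x₂ else u₂)
  factors-fall true  true  cl = solve 2 (λ x q → product I x I I I I I I I I I I q := q :* x) refl x₂ (closingFactor cl)
  factors-fall true  false cl = solve 2 (λ x q → product I x I I I I I I I I I I q := q :* x) refl x₂ (closingFactor cl)
  factors-fall false true  cl = solve 2 (λ x q → product I I I I I x I I I I I I q := q :* x) refl u₂ (closingFactor cl)
  factors-fall false false cl = solve 2 (λ x q → product I I I I I x I I I I I I q := q :* x) refl u₂ (closingFactor cl)

  factors-valley : ∀ ρ odd cl → factors ρ false false true false true false odd cl ≈ closingFactor cl * y₁
  factors-valley true  true  cl = solve 2 (λ x q → product I I x I I I I I I I I I q := q :* x) refl y₁ (closingFactor cl)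
  factors-valley true  false cl = solve 2 (λ x q → product I I x I I I I I I I I I q := q :* x) refl y₁ (closingFactor cl)
  factors-valley false true  cl = solve 2 (λ x q → product I I I I I I x I I I I I q := q :* x) refl y₁ (closingFactor cl)
  factors-valley false false cl = solve 2 (λ x q → product I I I I I I x I I I I I q := q :* x) refl y₁ (closingFactor cl)

  factors-rise : ∀ ρ odd cl → factors ρ false true false false true false odd cl ≈ closingFactor cl * (if ρ then y₂ else v₂)
  factors-rise true  true  cl = solve 2 (λ x q → product I I I x I I I I I I I I q := q :* x) refl y₂ (closingFactor cl)
  factors-rise true  false cl = solve 2 (λ x q → product I I I x I I I I I I I I q := q :* x) refl y₂ (closingFactor cl)
  factors-rise false true  cl = solve 2 (λ x q → product I I I I I I I x I I I I q := q :* x) refl v₂ (closingFactor cl)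
  factors-rise false false cl = solve 2 (λ x q → product I I I I I I I x I I I I q := q :* x) refl v₂ (closingFactor cl)

  -- A fixed point is a record exactly when it is an antirecord, hence one `r` for both. The
  -- preimage tests stay arbitrary, since each is conjoined with a false comparison.
  factors-fixed : ∀ r before after odd cl → factors r r before after false false true odd cl ≈
    closingFactor cl * (if odd then (if r then zₒ else wₒ) else (if r then zₑ else wₑ))
  factors-fixed r before after odd cl rewrite ∧-zeroʳ before | ∧-zeroʳ after with r | odd
  ... | true  | true  = solve 2 (λ x q → product I I I I I I I I I I I x q := q :* x) refl zₒ (closingFactor cl)
  ... | true  | false = solve 2 (λ x q → product I I I I I I I I I I x I q := q :* x) refl zₑ (closingFactor cl)
  ... | false | true  = solve 2 (λ x q → product I I I I I I I I I x I I q := q :* x) refl wₒ (closingFactor cl)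
  ... | false | false = solve 2 (λ x q → product I I I I I I I I x I I I q := q :* x) refl wₑ (closingFactor cl)

  first-if : ∀ x u h → first x u h ≡ (if h ≡ᵇ 0 then x else u)
  first-if x u zero    = ≡.refl
  first-if x u (suc h) = ≡.refl

  module _ {M : ℕ} (σ : Vec (Fin M) M) where
    open Perm σ
    open Positions σ

    factors-local : Injective → (∀ p → Alternating p) → ∀ i {T} → Aligned (suc (toℕ i)) T →
                    localWeight M (toℕ i) (ap i) T ≈ factorsAt σ i
    factors-local inj alt i {T} a = trans (reflexive (local-∉ M (toℕ i) (injective⇒∉ inj a ℕₚ.≤-refl)))
      (trans (*-congʳ (reflexive (if-cong (≡.sym (cycMin-endpoint inj a))))) (byOrder (ℕₚ.<-cmp (ap i) (toℕ i))))
      where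
      cl : Carrier
      cl = closingFactor (cycMin i)
      byOrder : _ → cl * kindWeight M (toℕ i) (ap i) T ≈ factorsAt σ i
      byOrder (tri< v<I v≢I _) = trans (*-congˡ (reflexive (≡.trans (kind-< M T v<I)
          (≡.trans (if-cong odd) (≡.cong₂ (if_then_else_ (does (toℕ i ∈? T))) (first-if x₂ u₂ _) (first-if x₁ u₁ _))))))
          main
        where
        odd : evenᵇ (toℕ i) ≡ false
        odd with true-or-false (evenᵇ (toℕ i))
        ... | inj₂ e = e
        ... | inj₁ e = contradiction v<I (ℕₚ.≤⇒≯ (proj₁ (alt i) e))
        main : cl * (if does (toℕ i ∈? T) then (if card (below (ap i) T) ≡ᵇ 0 then x₂ else u₂)
                                          else (if card (below (ap i) T) ≡ᵇ 0 then x₁ else u₁)) ≈ factorsAt σ i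
        main rewrite deficiency⇒¬rec inj a v<I | ≡.sym (arec-card inj a) | preimage-after inj a | preimage-before inj a v≢I
                   | <ᵇ-true v<I | <ᵇ-false (ℕₚ.<⇒≤ v<I) | ≡ᵇ-false v≢I with does (toℕ i ∈? T)
        ... | true  = sym (factors-fall (arec i) (evenᵇ (toℕ i)) (cycMin i))
        ... | false = sym (factors-peak (arec i) (evenᵇ (toℕ i)) (cycMin i))
      byOrder (tri> _ v≢I I<v) = trans (*-congˡ (reflexive (≡.trans (kind-> M T I<v) (if-cong even)))) main
        where
        even : evenᵇ (toℕ i) ≡ true
        even with true-or-false (evenᵇ (toℕ i))
        ... | inj₁ e = e
        ... | inj₂ e = contradiction I<v (ℕₚ.≤⇒≯ (proj₂ (alt i) e))
        main : cl * (if does (toℕ i ∈? T) then y₁ else (if maximalMissing M T (ap i) then y₂ else v₂)) ≈ factorsAt σ i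
        main rewrite excedance⇒¬arec inj a I<v | ≡.sym (rec-maximal inj a) | preimage-after inj a | preimage-before inj a v≢I
                   | <ᵇ-true I<v | <ᵇ-false (ℕₚ.<⇒≤ I<v) | ≡ᵇ-false v≢I with does (toℕ i ∈? T)
        ... | true  = sym (factors-valley (rec i) (evenᵇ (toℕ i)) (cycMin i))
        ... | false = sym (factors-rise (rec i) (evenᵇ (toℕ i)) (cycMin i))
      byOrder (tri≈ _ v≡I _) = trans (*-congˡ (reflexive (≡.trans (if-cong (≡ᵇ-true v≡I))
          (≡.cong₂ (if_then_else_ (evenᵇ (toℕ i))) (first-if zₒ wₒ _) (first-if zₑ wₑ _))))) main
        where
        main : cl * (if evenᵇ (toℕ i) then (if card (below (toℕ i) T) ≡ᵇ 0 then zₒ else wₒ)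
                                      else (if card (below (toℕ i) T) ≡ᵇ 0 then zₑ else wₑ)) ≈ factorsAt σ i
        main rewrite fixed⇒rec-card inj a v≡I
                   | ≡.trans (arec-card inj a) (≡.cong (λ v → card (below v T) ≡ᵇ 0) v≡I)
                   | ≡ᵇ-true v≡I | <ᵇ-false (ℕₚ.≤-reflexive v≡I) | <ᵇ-false (ℕₚ.≤-reflexive (≡.sym v≡I)) =
          sym (factors-fixed (card (below (toℕ i) T) ≡ᵇ 0) _ _ (evenᵇ (toℕ i)) (cycMin i))

    tailWeight-product : ∀ {k} i (T : Vec (Fin M) k) → i ℕ.+ k ≡ M → (ι : Fin k → Fin M) →
      (∀ j → toℕ (ι j) ≡ i ℕ.+ toℕ j) → (∀ j → lookup σ (ι j) ≡ lookup T j) → (f : Fin M → Carrier) →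
      (∀ p {T} → Aligned (suc (toℕ p)) T → localWeight M (toℕ p) (ap p) T ≈ f p) →
      tailWeight M i (vals T) ≈ prodL (tabulate (f ∘ ι))
    tailWeight-product i []      e ι ιp ιv f loc = refl
    tailWeight-product i (v ∷ T) e ι ιp ιv f loc = *-cong
      (trans (reflexive (≡.cong₂ (λ j w → localWeight M j (toℕ w) (vals T)) (≡.sym p≡i) (≡.sym (ιv zero))))
             (loc (ι zero) (≡.subst (λ j → Aligned (suc j) (vals T)) (≡.sym p≡i)
                (aligned-vals (suc i) T e′ (ι ∘ suc) ιp′ (ιv ∘ suc)))))
      (tailWeight-product (suc i) T e′ (ι ∘ suc) ιp′ (ιv ∘ suc) f loc)
      where
      p≡i : toℕ (ι zero) ≡ i
      p≡i = ≡.trans (ιp zero) (ℕₚ.+-identityʳ i)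
      e′ : suc i ℕ.+ _ ≡ M
      e′ = ≡.trans (≡.sym (ℕₚ.+-suc i _)) e
      ιp′ : ∀ j → toℕ (ι (suc j)) ≡ suc i ℕ.+ toℕ j
      ιp′ j = ≡.trans (ιp (suc j)) (ℕₚ.+-suc i (toℕ j))

    weight-tailWeight : Injective → (∀ p → Alternating p) →
      weight x₁ x₂ y₁ y₂ u₁ u₂ y₁ v₂ wₑ wₒ zₑ zₒ λ' σ ≈ tailWeight M 0 (vals σ)
    weight-tailWeight inj alt = begin
      weight x₁ x₂ y₁ y₂ u₁ u₂ y₁ v₂ wₑ wₒ zₑ zₒ λ' σ
        ≈⟨ weight-factors σ ⟩
      prodL (map (factorsAt σ) fins)
        ≡⟨ ≡.cong prodL (map-tabulate id (factorsAt σ)) ⟩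
      prodL (tabulate (factorsAt σ))
        ≈⟨ tailWeight-product 0 σ ≡.refl id (λ _ → ≡.refl) (λ _ → ≡.refl) (factorsAt σ) (factors-local inj alt) ⟨
      tailWeight M 0 (vals σ) ∎

    IsZeroOrGood : ℕ → List ℕ → Set ℓ
    IsZeroOrGood i T = tailWeight M i T ≈ 0# ⊎ (Tail M i T × (∀ p → i ≤ toℕ p → Alternating p))

    -- An arbitrary ring has no test for zero, so the alternative is decided on the vector: the
    -- first defect met supplies a zero factor, and without defects σ is a D-permutation.
    zero-or-good : ∀ {i T} → Aligned i T → IsZeroOrGood i T
    zero-or-good [] = inj₂ ([] , λ p M≤p → contradiction (toℕ<n p) (ℕₚ.≤⇒≯ M≤p))
    zero-or-good (_∷_ p {T} a) with zero-or-good a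
    ... | inj₁ z = inj₁ (trans (*-congˡ z) (zeroʳ _))
    ... | inj₂ (t , alt) with toSum (ap p ∈? T)
    ...   | inj₁ v∈T = inj₁ (trans (*-congʳ (reflexive (local-∈ M (toℕ p) v∈T))) (zeroˡ _))
    ...   | inj₂ v∉T = extend (alternating? (true-or-false (evenᵇ (toℕ p))))
      where
      alternating? : evenᵇ (toℕ p) ≡ true ⊎ evenᵇ (toℕ p) ≡ false →
                     localWeight M (toℕ p) (ap p) T ≈ 0# ⊎ Alternating p
      alternating? (inj₁ e) with ap p <? toℕ p
      ... | yes v<p = inj₁ (local-low M v<p v∉T e)
      ... | no v≮p  = inj₂ ((λ _ → ℕₚ.≮⇒≥ v≮p) , (λ e′ → contradiction (≡.trans (≡.sym e) e′) (λ ())))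
      alternating? (inj₂ e) with toℕ p <? ap p
      ... | yes p<v = inj₁ (local-high M p<v v∉T e)
      ... | no p≮v  = inj₂ ((λ e′ → contradiction (≡.trans (≡.sym e) e′) (λ ())) , (λ _ → ℕₚ.≮⇒≥ p≮v))
      extend : localWeight M (toℕ p) (ap p) T ≈ 0# ⊎ Alternating p → IsZeroOrGood (toℕ p) (ap p ∷ T)
      extend (inj₁ z) = inj₁ (trans (*-congʳ z) (zeroˡ _))
      extend (inj₂ h) = inj₂ ((toℕ<n (lookup σ p) , v∉T) ∷ t , alt′)
        where
        alt′ : ∀ q → toℕ p ≤ toℕ q → Alternating q
        alt′ q p≤q with toℕ p ≟ toℕ q
        ... | no p≢q = alt q (ℕₚ.≤∧≢⇒< p≤q p≢q)
        ... | yes e with ≡.refl ← toℕ-injective {i = p} {q} e = h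

    weight-if : (if isPerm ∧ isD then weight x₁ x₂ y₁ y₂ u₁ u₂ y₁ v₂ wₑ wₒ zₑ zₒ λ' σ else 0#) ≈
                tailWeight M 0 (vals σ)
    weight-if with true-or-false (isPerm ∧ isD)
    ... | inj₁ e = trans (reflexive (if-cong e))
            (weight-tailWeight (isPerm⇒ (proj₁ (∧-true⁻ e))) (isD⇒ (proj₂ (∧-true⁻ {isPerm} e))))
    ... | inj₂ e = trans (reflexive (if-cong e)) (zeroCase (zero-or-good aligned))
      where
      zeroCase : IsZeroOrGood 0 (vals σ) → 0# ≈ tailWeight M 0 (vals σ)
      zeroCase (inj₁ z) = sym z
      zeroCase (inj₂ (t , alt)) = contradiction (≡.trans (≡.sym e)
        (≡.cong₂ _∧_ (⇒isPerm (tail⇒injective aligned t z≤n z≤n)) (⇒isD (λ p → alt p z≤n)))) (λ ())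

  sumL-filter : ∀ {A : Set} (f : A → Carrier) p xs →
    sumL (map f (filterᵇ p xs)) ≈ sumL (map (λ x → if p x then f x else 0#) xs)
  sumL-filter f p []       = refl
  sumL-filter f p (x ∷ xs) with p x
  ... | true  = +-congˡ (sumL-filter f p xs)
  ... | false = trans (sumL-filter f p xs) (sym (+-identityˡ _))

theorem4p1 : {c ℓ : Level} (R : CommutativeRing c ℓ)
    (x₁ x₂ y₁ y₂ u₁ u₂ v₂ wₑ wₒ zₑ zₒ λ' : CommutativeRing.Carrier R)
    (n N : ℕ) → n < N →
    CommutativeRing._≈_ R
    (Series.Phat R x₁ x₂ y₁ y₂ u₁ u₂ y₁ v₂ wₑ wₒ zₑ zₒ λ' n)
    (Series.CF.cfCoeff R x₁ x₂ y₁ y₂ u₁ u₂ v₂ wₑ wₒ zₑ zₒ λ' N n)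
theorem4p1 R x₁ x₂ y₁ y₂ u₁ u₂ v₂ wₑ wₒ zₑ zₒ λ' n N n<N = begin
  Phat x₁ x₂ y₁ y₂ u₁ u₂ y₁ v₂ wₑ wₒ zₑ zₒ λ' n
    ≈⟨ sumL-filter _ (λ σ → Perm.isPerm σ ∧ Perm.isD σ) (vecs M M) ⟩
  sumL (map (λ σ → if Perm.isPerm σ ∧ Perm.isD σ
                   then weight x₁ x₂ y₁ y₂ u₁ u₂ y₁ v₂ wₑ wₒ zₑ zₒ λ' σ else 0#) (vecs M M))
    ≈⟨ sumL-cong (vecs M M) weight-if ⟩
  sumL (map (λ σ → tailWeight M 0 (vals σ)) (vecs M M))
    ≈⟨ sum-tailWeight M ⟩
  completion M (emptySubset M)
    ≡⟨ ≡.cong (λ m → completion m (emptySubset m)) (n+n≡double n) ⟩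
  completion (double n) (emptySubset (double n))
    ≈⟨ completion-∅ n ⟩
  tailCoeff 0 n
    ≈⟨ cfCoeff-tailCoeff n N n<N ⟨
  CF.cfCoeff x₁ x₂ y₁ y₂ u₁ u₂ v₂ wₑ wₒ zₑ zₒ λ' N n ∎
  where
  open CommutativeRing R hiding (zero)
  open Series R
  open ListSums R using (sumL-cong)
  open Heights R x₁ x₂ y₁ y₂ u₁ u₂ v₂ wₑ wₒ zₑ zₒ λ' using (completion; completion-∅)
  open ContinuedFraction R x₁ x₂ y₁ y₂ u₁ u₂ v₂ wₑ wₒ zₑ zₒ λ' using (tailCoeff; cfCoeff-tailCoeff)
  open LocalWeights R x₁ x₂ y₁ y₂ u₁ u₂ v₂ wₑ wₒ zₑ zₒ λ' using (tailWeight; sum-tailWeight)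
  open PermutationWeights R x₁ x₂ y₁ y₂ u₁ u₂ v₂ wₑ wₒ zₑ zₒ λ' using (weight-if; sumL-filter)
  open SetoidReasoning setoid
  M : ℕ
  M = n ℕ.+ n
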